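{- Let $x,y,z,n$ be odd positive integers with $n\ge 3$ and $\gcd(x,z)=\gcd(y,z)=1$, and let $w$ be a positive integer with $w\notin\{2,6\}$. Then, for nonnegative integers $s,r$ with $s\neq1$, $r\neq 1$: (a) if $s+r=xyzw$, then $C_{(xyzw:n)}$ can be decomposed into $s$ $C_{xzn}$-factors and $r$ $C_{yzn}$-factors; (b) if $s+r=4xzw$, then $C_{(4xzw:n)}$ can be decomposed into $s$ $C_{2xzn}$-factors and $r$ $C_{2zn}$-factors; (c) if $s+r=4xzw$, then $C_{(4xzw:n)}$ can be decomposed into $s$ $C_{2xzn}$-factors and $r$ $C_{zn}$-factors; (d) if $s+r=4xzw$, then $C_{(4xzw:n)}$ can be decomposed into $s$ $C_{xzn}$-factors and $r$ $C_{2zn}$-factors; (e) if $s+r=4xyzw$, then $C_{(4xyzw:n)}$ can be decomposed into $s$ $C_{2xzn}$-factors and $r$ $C_{yzn}$-factors; (f) if $s+r=4xyzw$, then $C_{(4xyzw:n)}$ can be decomposed into $s$ $C_{2xzn}$-factors and $r$ $C_{2yzn}$-factors.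
   Context: For positive integers $v$ and $k\ge 3$, the complete cyclic multipartite graph $C_{(v:k)}$ has vertex set $\{(g,i): 0\le g\le v-1,\ i\in\mathbb{Z}_k\}$ (the $k$ parts are $\{(g,i):0\le g\le v-1\}$ for fixed $i$), and $(g,i)$, $(h,j)$ are adjacent iff $i-j\equiv\pm1\pmod k$. A $C_\ell$-factor of a graph is a spanning subgraph each of whose components is a cycle of length $\ell$. A decomposition into factors is a partition of the edge set into such spanning subgraphs. -}

module Defs where

open import Data.Nat using (ℕ; suc; _+_; _≤_)
open import Data.Nat.Divisibility using (_∣_)
open import Data.Fin using (Fin; toℕ)
open import Data.Product using (Σ; ∃; ∃!; _×_; _,_)
open import Data.Sum using (_⊎_; inj₁; inj₂)
open import Relation.Nullary using (¬_)
open import Relation.Binary.PropositionalEquality using (_≡_)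

-- Odd natural numbers (an odd number is automatically positive).
Odd : ℕ → Set
Odd n = ¬ (2 ∣ n)

IsNext : (k : ℕ) → Fin k → Fin k → Set
IsNext k i j = (suc (toℕ i) ≡ toℕ j) ⊎ (suc (toℕ i) ≡ k × toℕ j ≡ 0)

-- Vertices of C_(v:k): pairs (g , i) with g ∈ {0..v-1}, i ∈ ℤ_k.
Vtx : ℕ → ℕ → Set
Vtx v k = Fin v × Fin k

Adj : (v k : ℕ) → Vtx v k → Vtx v k → Set
Adj v k (g , i) (h , j) = IsNext k i j ⊎ IsNext k j i

-- A C_ℓ-factor of C_(v:k): a family of m cycles of length ℓ, each given
-- by its cyclic vertex sequence  Fin ℓ → Vtx v k,  such that consecutive
-- vertices are adjacent in the graph and every vertex of the graph occurs
-- at exactly one position (c , t) (so cycles are simple, pairwise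
-- vertex-disjoint, and together span the vertex set).
record CFactor (v k ℓ : ℕ) : Set where
  field
    len≥3   : 3 ≤ ℓ
    m       : ℕ
    vert    : Fin m → Fin ℓ → Vtx v k
    edgesOk : ∀ c t t' → IsNext ℓ t t' → Adj v k (vert c t) (vert c t')
    cover   : ∀ p → ∃! _≡_ (λ (ct : Fin m × Fin ℓ) →
                let (c , t) = ct in vert c t ≡ p)

open CFactor public

DEdgeIn : ∀ {v k ℓ} → CFactor v k ℓ → Vtx v k → Vtx v k → Set
DEdgeIn {ℓ = ℓ} F p q =
  ∃ λ c → ∃ λ t → ∃ λ t' → IsNext ℓ t t' × vert F c t ≡ p × vert F c t' ≡ q

EdgeIn : ∀ {v k ℓ} → CFactor v k ℓ → Vtx v k → Vtx v k → Set
EdgeIn F p q = DEdgeIn F p q ⊎ DEdgeIn F q p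

-- A decomposition of C_(v:k) into s C_a-factors and r C_b-factors:
-- families of factors such that every edge of C_(v:k) lies in exactly one
-- of the s + r factors (factor edges are graph edges by 'edgesOk').
Decomp : (v k s a r b : ℕ) → Set
Decomp v k s a r b =
  Σ (Fin s → CFactor v k a) λ A →
  Σ (Fin r → CFactor v k b) λ B →
  ∀ p q → Adj v k p q →
    ∃! _≡_ (λ (i : Fin s ⊎ Fin r) → F i p q A B)
  where
  F : Fin s ⊎ Fin r → Vtx v k → Vtx v k →
      (Fin s → CFactor v k a) → (Fin r → CFactor v k b) → Set
  F (inj₁ i) p q A B = EdgeIn (A i) p q
  F (inj₂ j) p q A B = EdgeIn (B j) p q

{-# OPTIONS --safe #-}
module Submission where

-- For n = 3 + 2k, a factor is given by permutations of {0, …, v-1} between consecutive parts,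
-- and its cycle lengths are n times those of the composite around the circle.  Parts beyond
-- the third cancel in pairs, so three permutations decide.
--
-- The vertices of a part are identified with G × W, where |W| = w and G is an abelian group
-- with zero total sum: G = ℤ_xyz in (a), and G = ℤ₂² × ℤ_m with m = xz or m = xyz otherwise.
-- On W the permutations come from two orthogonal Latin squares of order w (Bose, Shrikhande and
-- Parker; this is where w ∉ {2, 6} enters) and compose to the identity.  On G they are
-- translations, so that the composite is the translation by a group element d and all cycles
-- have length n · ord d.  By Hall's theorem every family (d_g) indexed by G with zero sum is
-- a sum of three bijections onto G; hence it suffices to split s and r over the w blocks such
-- that the required element orders are realised with zero sum in every block, for which the
-- families g, -g and g, g, -2g (g, h, g + h in ℤ₂²) suffice.

-- Oddness of n is what costs two orthogonal Latin squares. On an even circle every pass could be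
-- undone by the next one and a single square would do; an odd circle needs a closed walk of odd
-- length, and 0 → 1 → 2 → 0 through three groups of a transversal design is the shortest. The
-- fourth group labels the factors, whence designs with four groups.
--
-- Within a block each of the three layers uses every element of G once, so the displacements of the
-- block must add up to three times the sum of G. In a cyclic group of even order the elements add
-- up to the involution, and the block would have to do so too; ℤ₂² × ℤ_m supplies even orders while
-- its elements add up to zero.
--
-- An element of order greater than 1 is not a zero-sum family by itself. This is the obstacle
-- behind s, r ≠ 1, and it returns inside the blocks: a split over the blocks must not strand one
-- element in any of them. From u = 5 on a stranded element can always be redistributed; the groups
-- with fewer elements are treated through the few orders that they admit.

open import Data.Empty using (⊥; ⊥-elim)
open import Data.Fin using (Fin; zero; suc; toℕ; fromℕ<; #_; punchIn; splitAt; inject₁; fromℕ)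
open import Data.Nat as ℕ using (ℕ; zero; suc; _≤_; _<_; NonZero; z≤n; s≤s)
import Data.Nat.Properties as ℕ
open import Data.Nat.Tactic.RingSolver using (solve-∀)
open import Data.Product using (Σ; _×_; _,_; ∃; proj₁; proj₂; ∃!)
open import Data.Product.Function.NonDependent.Propositional using (_×-↔_)
open import Data.Sum using (inj₁; inj₂; _⊎_; map₁; map₂; [_,_]; [_,_]′; swap; map)
open import Data.Sum.Function.Propositional using (_⊎-↔_)
open import Function using (_↔_; Inverse; _∘_; const; mk↔ₛ′)
open import Function.Construct.Composition using (_↔-∘_)
open import Function.Construct.Identity using (↔-id)
open import Function.Construct.Symmetry using (↔-sym)
open import Relation.Binary.PropositionalEquality hiding ([_])
open import Relation.Nullary using (yes; no; Dec; contradiction; ¬?)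
open Inverse using (to; from; strictlyInverseˡ; strictlyInverseʳ)

-- Hall's theorem on sums of bijections onto a finite abelian group

module HallTheorem where
  open import Algebra.Bundles using (AbelianGroup)
  open import Algebra.Structures using (IsAbelianGroup)
  import Algebra.Properties.AbelianGroup as AbelianGroupProperties
  import Algebra.Properties.CommutativeMonoid.Sum as Summation
  import Algebra.Properties.CommutativeSemigroup as CommutativeSemigroupProperties
  open import Data.Fin.Properties using (toℕ-injective; toℕ-fromℕ<; toℕ<n; punchInᵢ≢i) renaming (_≟_ to _≟ᶠ_)
  open import Data.Fin.Permutation using (transpose)
  import Data.Fin.Permutation.Components as PC
  open import Data.Fin.Subset using (Subset; _∈_; _∉_; ⊤; ∣_∣) renaming (_-_ to _∖_)
  open import Data.Fin.Subset.Properties using (_∈?_; ∈⊤; x∈p∧x≢y⇒x∈p-y; x∈p⇒∣p-x∣<∣p∣; p─q⊆p; p─q─q≡p─q)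
  open import Data.Vec.Functional using (removeAt)
  open import Level using (0ℓ)
  open import Relation.Nullary.Decidable using (dec-true; dec-false)

  to-injective : ∀ {A B : Set} (f : A ↔ B) {x y} → to f x ≡ to f y → x ≡ y
  to-injective f {x} {y} eq =
    trans (sym (strictlyInverseʳ f x)) (trans (cong (from f) eq) (strictlyInverseʳ f y))

  transpose-left : ∀ {n} (i j : Fin n) → PC.transpose i j i ≡ j
  transpose-left i j rewrite dec-true (i ≟ᶠ i) refl = refl

  transpose-right : ∀ {n} (i j : Fin n) → PC.transpose i j j ≡ i
  transpose-right i j with j ≟ᶠ i
  ... | yes j≡i = j≡i
  ... | no  _ rewrite dec-true (j ≟ᶠ j) refl = refl

  transpose-other : ∀ {n} (i j : Fin n) {k} → k ≢ i → k ≢ j → PC.transpose i j k ≡ k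
  transpose-other i j {k} k≢i k≢j rewrite dec-false (k ≟ᶠ i) k≢i | dec-false (k ≟ᶠ j) k≢j = refl

  x∉p-x : ∀ {n} (p : Subset n) x → x ∉ p ∖ x
  x∉p-x p x x∈ = ℕ.<-irrefl refl
    (subst (λ q → ∣ q ∣ < ∣ p ∖ x ∣) (p─q─q≡p─q p _) (x∈p⇒∣p-x∣<∣p∣ x∈))

  record FiniteAbelianGroup (u : ℕ) : Set₁ where
    infixl 6 _+_
    field
      G : Set
      _+_ : G → G → G
      0# : G
      -_ : G → G
      isAbelianGroup : IsAbelianGroup _≡_ _+_ 0# -_
      enum : Fin u ↔ G

    abelianGroup : AbelianGroup 0ℓ 0ℓ
    abelianGroup = record { isAbelianGroup = isAbelianGroup }

    open AbelianGroup abelianGroup public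
      using (commutativeMonoid; monoid)
      renaming (assoc to +-assoc; comm to +-comm; identityˡ to +-identityˡ; identityʳ to +-identityʳ;
                inverseˡ to +-inverseˡ; inverseʳ to +-inverseʳ)
    open AbelianGroupProperties abelianGroup public using () renaming (∙-cancelˡ to +-cancelˡ; ∙-cancelʳ to +-cancelʳ)
    open CommutativeSemigroupProperties (AbelianGroup.commutativeSemigroup abelianGroup) public
      using () renaming (interchange to +-interchange)
    open Summation commutativeMonoid public using (sum; sum-permute; sum-cong-≗; sum-remove; ∑-distrib-+)

  module Exchange {u} (𝔾 : FiniteAbelianGroup u) where
    open FiniteAbelianGroup 𝔾

    -- This makes the waste row come out right for free, once the other rows and the totals agree.
    sum-determines-entry : ∀ {n} (f g : Fin n → G) j → sum f ≡ sum g → (∀ k → k ≢ j → f k ≡ g k) → f j ≡ g j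
    sum-determines-entry {suc n} f g j Σf≡Σg f≗g = +-cancelʳ (sum (removeAt f j)) (f j) (g j) (begin
      f j + sum (removeAt f j) ≡⟨ sum-remove f ⟨
      sum f                    ≡⟨ Σf≡Σg ⟩
      sum g                    ≡⟨ sum-remove g ⟩
      g j + sum (removeAt g j) ≡⟨ cong (g j +_) (sum-cong-≗ (λ k → f≗g (punchIn j k) (punchInᵢ≢i j k ))) ⟨
      g j + sum (removeAt f j) ∎)
      where open ≡-Reasoning

    sum-bijection : (a : Fin u ↔ G) → sum (to a) ≡ sum (to enum)
    sum-bijection a = sym (trans (sum-permute (to enum) (↔-sym enum ↔-∘ a))
      (sum-cong-≗ (λ k → strictlyInverseˡ enum (to a k))))

    -- Hall's exchange argument.  Row j is the waste row.  The current row exchanges its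
    -- c-entry with row j and its a-entry with the row k′ holding the required value; every
    -- processed row thereby gets reflected to (K + c , a - K), which preserves its sum, so no
    -- row is met twice and the process ends.  U is the set of unprocessed rows, and γ is the
    -- c-bijection before the process starts.
    exchange : ∀ fuel (U : Subset u) → ∣ U ∣ ≤ fuel → (a c : Fin u ↔ G) (d γ : Fin u → G) (K : G) (i j : Fin u) →
      i ≢ j → (∀ {k l} → γ k ≡ γ l → k ≡ l) → i ∈ U →
      (∀ k → k ≢ i → k ≢ j → to a k + to c k ≡ d k) →
      K + (to c i + to c j) ≡ d i →
      (∀ k → k ∈ U → k ≢ j → to c k ≡ γ k) →
      (∀ k → k ∉ U → to a k ≡ K + γ k) →
      Σ (Fin u ↔ G) λ a′ → Σ (Fin u ↔ G) λ c′ → ∀ k → k ≢ j → to a′ k + to c′ k ≡ d k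
    exchange zero U ∣U∣≤0 a c d γ K i j i≢j γ-inj i∈U correct K-eq fresh done =
      contradiction (ℕ.≤-trans (x∈p⇒∣p-x∣<∣p∣ i∈U) ∣U∣≤0) λ ()
    exchange (suc fuel) U ∣U∣≤ a c d γ K i j i≢j γ-inj i∈U correct K-eq fresh done
      with from a (K + to c i) in k′-eq
    ... | k′ = go (k′ ≟ᶠ j) (k′ ≟ᶠ i)
      where
      a₁ c₁ : Fin u ↔ G
      a₁ = a ↔-∘ transpose i k′
      c₁ = c ↔-∘ transpose i j

      a-k′ : to a k′ ≡ K + to c i
      a-k′ = trans (cong (to a) (sym k′-eq)) (strictlyInverseˡ a _)

      a₁-i : to a₁ i ≡ K + to c i
      a₁-i = trans (cong (to a) (transpose-left i k′)) a-k′

      a₁-other : ∀ {k} → k ≢ i → k ≢ k′ → to a₁ k ≡ to a k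
      a₁-other p q = cong (to a) (transpose-other i k′ p q)

      c₁-i : to c₁ i ≡ to c j
      c₁-i = cong (to c) (transpose-left i j)

      c₁-j : to c₁ j ≡ to c i
      c₁-j = cong (to c) (transpose-right i j)

      c₁-other : ∀ {k} → k ≢ i → k ≢ j → to c₁ k ≡ to c k
      c₁-other p q = cong (to c) (transpose-other i j p q)

      row-i : to a₁ i + to c₁ i ≡ d i
      row-i = trans (cong₂ _+_ a₁-i c₁-i) (trans (+-assoc _ _ _) K-eq)

      row-other : ∀ {k} → k ≢ i → k ≢ j → k ≢ k′ → to a₁ k + to c₁ k ≡ d k
      row-other p q r = trans (cong₂ _+_ (a₁-other p r) (c₁-other p q)) (correct _ p q)

      row : ∀ {k} → Dec (k ≡ i) → (k ≢ i → to a₁ k + to c₁ k ≡ d k) → to a₁ k + to c₁ k ≡ d k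
      row (yes refl) _ = row-i
      row (no k≢i) f = f k≢i

      finish : (∀ {k} → k ≢ i → k ≢ j → k ≢ k′) →
        Σ (Fin u ↔ G) λ a′ → Σ (Fin u ↔ G) λ c′ → ∀ k → k ≢ j → to a′ k + to c′ k ≡ d k
      finish k′-not-new = a₁ , c₁ , rows
        where
        rows : ∀ k → k ≢ j → to a₁ k + to c₁ k ≡ d k
        rows k k≢j = row (k ≟ᶠ i) λ k≢i → row-other k≢i k≢j (k′-not-new k≢i k≢j)

      go : Dec (k′ ≡ j) → Dec (k′ ≡ i) →
        Σ (Fin u ↔ G) λ a′ → Σ (Fin u ↔ G) λ c′ → ∀ k → k ≢ j → to a′ k + to c′ k ≡ d k
      -- Both exits harm no constrained row: the sum of the waste row is free, and for k′ = i the
      -- required a-entry already stands in row i.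
      go (yes k′≡j) _ = finish λ _ k≢j k≡k′ → k≢j (trans k≡k′ k′≡j)
      go _ (yes k′≡i) = finish λ k≢i _ k≡k′ → k≢i (trans k≡k′ k′≡i)
      go (no k′≢j) (no k′≢i) =
        exchange fuel (U ∖ i) (ℕ.≤-pred (ℕ.≤-trans (x∈p⇒∣p-x∣<∣p∣ i∈U) ∣U∣≤))
          a₁ c₁ d γ K k′ j k′≢j γ-inj (x∈p∧x≢y⇒x∈p-y k′∈U k′≢i)
          correct₁ K-eq₁ fresh₁ done₁
        where
        -- A processed k′ would give K + γ k′ = a k′ = K + c i = K + γ i, hence k′ = i.
        k′∈U : k′ ∈ U
        k′∈U with k′ ∈? U
        ... | yes p = p
        ... | no k′∉U = contradiction
          (γ-inj (trans (+-cancelˡ K _ _ (trans (sym (done k′ k′∉U)) a-k′)) (fresh i i∈U i≢j))) k′≢i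

        correct₁ : ∀ k → k ≢ k′ → k ≢ j → to a₁ k + to c₁ k ≡ d k
        correct₁ k k≢k′ k≢j = row (k ≟ᶠ i) λ k≢i → row-other k≢i k≢j k≢k′

        -- The same K serves the next row: row j now holds the old c i, and a k′ = K + c i, so the
        -- old row sum d k′ is what K must complete.
        K-eq₁ : K + (to c₁ k′ + to c₁ j) ≡ d k′
        K-eq₁ = begin
          K + (to c₁ k′ + to c₁ j) ≡⟨ cong (K +_) (cong₂ _+_ (c₁-other k′≢i k′≢j) c₁-j) ⟩
          K + (to c k′ + to c i)   ≡⟨ cong (K +_) (+-comm _ _) ⟩
          K + (to c i + to c k′)   ≡⟨ +-assoc _ _ _ ⟨
          (K + to c i) + to c k′   ≡⟨ cong (_+ to c k′) a-k′ ⟨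
          to a k′ + to c k′        ≡⟨ correct k′ k′≢i k′≢j ⟩
          d k′ ∎
          where open ≡-Reasoning

        fresh₁ : ∀ k → k ∈ U ∖ i → k ≢ j → to c₁ k ≡ γ k
        fresh₁ k k∈ k≢j = trans (c₁-other (λ { refl → x∉p-x U i k∈ }) k≢j) (fresh k (p─q⊆p U _ k∈) k≢j)

        done₁ : ∀ k → k ∉ U ∖ i → to a₁ k ≡ K + γ k
        done₁ k k∉ = done₁′ (k ≟ᶠ i)
          where
          done₁′ : Dec (k ≡ i) → to a₁ k ≡ K + γ k
          done₁′ (yes refl) = trans a₁-i (cong (K +_) (fresh i i∈U i≢j))
          done₁′ (no k≢i) = trans (a₁-other k≢i (λ { refl → k∉ (x∈p∧x≢y⇒x∈p-y k′∈U k≢i) }))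
                             (done k (λ k∈U → k∉ (x∈p∧x≢y⇒x∈p-y k∈U k≢i)))

    -- The exchange runs towards the present row sums, altered in row i only, and starts with all
    -- rows unprocessed.
    fix-row : (a c : Fin u ↔ G) (e : G) (i j : Fin u) → i ≢ j →
      Σ (Fin u ↔ G) λ a′ → Σ (Fin u ↔ G) λ c′ →
        to a′ i + to c′ i ≡ e × (∀ k → k ≢ i → k ≢ j → to a′ k + to c′ k ≡ to a k + to c k)
    fix-row a c e i j i≢j =
      let a′ , c′ , rows = exchange ∣ ⊤ {u} ∣ ⊤ ℕ.≤-refl a c d (to c) K i j i≢j (to-injective c) ∈⊤
            (λ k k≢i _ → sym (d-other k≢i)) K-eq (λ _ _ _ → refl) (λ k k∉ → contradiction ∈⊤ k∉)
      in a′ , c′ , trans (rows i i≢j) d-i , λ k k≢i k≢j → trans (rows k k≢j) (d-other k≢i)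
      where
      d : Fin u → G
      d k with k ≟ᶠ i
      ... | yes _ = e
      ... | no  _ = to a k + to c k
      d-i : d i ≡ e
      d-i with i ≟ᶠ i
      ... | yes _ = refl
      ... | no i≢i = contradiction refl i≢i
      d-other : ∀ {k} → k ≢ i → d k ≡ to a k + to c k
      d-other {k} k≢i with k ≟ᶠ i
      ... | yes k≡i = contradiction k≡i k≢i
      ... | no _ = refl
      -- After the first exchange row i is (K + c i , c j); this K makes its sum e.
      K : G
      K = e + (- (to c i + to c j))
      K-eq : K + (to c i + to c j) ≡ d i
      K-eq = trans (+-assoc _ _ _) (trans (cong (e +_) (+-inverseˡ _)) (trans (+-identityʳ e) (sym d-i)))

    fix-rows : (d : Fin u → G) (j : Fin u) → ∀ N → N ≤ u →
      Σ (Fin u ↔ G) λ a → Σ (Fin u ↔ G) λ c → ∀ k → k ≢ j → toℕ k < N → to a k + to c k ≡ d k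
    fix-rows d j zero _ = enum , enum , λ _ _ ()
    fix-rows d j (suc N) N<u with fix-rows d j N (ℕ.<⇒≤ N<u)
    ... | a , c , rows with fromℕ< N<u ≟ᶠ j
    ... | yes N≡j = a , c , λ k k≢j k<1+N → rows k k≢j (ℕ.≤∧≢⇒< (ℕ.≤-pred k<1+N)
            λ k≡N → k≢j (trans (toℕ-injective (trans k≡N (sym (toℕ-fromℕ< N<u)))) N≡j))
    ... | no N≢j with fix-row a c (d (fromℕ< N<u)) (fromℕ< N<u) j N≢j
    ... | a′ , c′ , new , old = a′ , c′ , rows′
      where
      rows′ : ∀ k → k ≢ j → toℕ k < suc N → to a′ k + to c′ k ≡ d k
      rows′ k k≢j k<1+N with k ≟ᶠ fromℕ< N<u
      ... | yes refl = new
      ... | no k≢N = trans (old k k≢N k≢j) (rows k k≢j (ℕ.≤∧≢⇒< (ℕ.≤-pred k<1+N)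
            λ k≡N → k≢N (toℕ-injective (trans k≡N (sym (toℕ-fromℕ< N<u))))))

    -- The enumeration serves as the third bijection and is subtracted from d beforehand. Whatever a
    -- and c are, the total of T is three times the sum of G, hence zero like that of d, and the
    -- uncorrected row j agrees as well.
    sum-of-three-bijections : sum (to enum) ≡ 0# → Fin u → (d : Fin u → G) → sum d ≡ 0# →
      Σ (Fin 3 → Fin u ↔ G) λ a → ∀ k → (to (a (# 0)) k + to (a (# 1)) k) + to (a (# 2)) k ≡ d k
    sum-of-three-bijections ΣG≡0 j d Σd≡0 with fix-rows (λ k → d k + (- to enum k)) j u ℕ.≤-refl
    ... | a , c , rows = three , all-rows
      where
      three : Fin 3 → Fin u ↔ G
      three zero = a
      three (suc zero) = c
      three (suc (suc zero)) = enum

      T : Fin u → G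
      T k = (to a k + to c k) + to enum k

      T≗d : ∀ k → k ≢ j → T k ≡ d k
      T≗d k k≢j = trans (cong (_+ to enum k) (rows k k≢j (toℕ<n k)))
        (trans (+-assoc _ _ _) (trans (cong (d k +_) (+-inverseˡ _)) (+-identityʳ _)))

      ΣT≡0 : sum T ≡ 0#
      ΣT≡0 = begin
        sum T                                               ≡⟨ ∑-distrib-+ (λ k → to a k + to c k) (to enum) ⟩
        sum (λ k → to a k + to c k) + sum (to enum)         ≡⟨ cong (_+ sum (to enum)) (∑-distrib-+ (to a) (to c)) ⟩
        (sum (to a) + sum (to c)) + sum (to enum)           ≡⟨ cong₂ (λ p q → (p + q) + sum (to enum)) (sum-bijection a) (sum-bijection c) ⟩
        (sum (to enum) + sum (to enum)) + sum (to enum)     ≡⟨ cong (λ z → (z + z) + z) ΣG≡0 ⟩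
        (0# + 0#) + 0#                                      ≡⟨ trans (+-identityʳ _) (+-identityʳ _) ⟩
        0#                                                  ∎
        where open ≡-Reasoning

      all-rows : ∀ k → T k ≡ d k
      all-rows k with k ≟ᶠ j
      ... | yes refl = sum-determines-entry T d j (trans ΣT≡0 (sym Σd≡0)) T≗d
      ... | no k≢j = T≗d k k≢j

open HallTheorem

-- Residue arithmetic inherited from the integers

module ModularArithmetic where
  import Algebra.Properties.Monoid.Mult as Multiples
  open import Data.Fin.Properties using (toℕ-injective; toℕ-fromℕ<; toℕ<n)
  open import Data.Integer as ℤ using (ℤ; +_; 0ℤ)
  open import Data.Integer.DivMod using (_%ℕ_; _/ℕ_; n%ℕd<d; a≡a%ℕn+[a/ℕn]*n)
  open import Data.Integer.Divisibility.Signed using (divides; ∣⇒∣ᵤ; ∣m∣n⇒∣m+n; ∣m∣n⇒∣m-n; ∣m⇒∣-m) renaming (_∣_ to _∣ᶻ_)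
  import Data.Integer.Properties as ℤ
  open import Data.Integer.Solver using (module +-*-Solver)
  open import Data.Nat.Divisibility as ℕ using (_∣_)

  open +-*-Solver using (solve; _:+_; _:*_; :-_; _:-_; _:=_; con)

  module Residues (m : ℕ) .{{_ : NonZero m}} where

    ⟦_⟧ : ℤ → Fin m
    ⟦ a ⟧ = fromℕ< (n%ℕd<d a m)

    val : Fin m → ℤ
    val i = + toℕ i

    m∣val⟦a⟧-a : ∀ a → + m ∣ᶻ val ⟦ a ⟧ ℤ.- a
    m∣val⟦a⟧-a a = divides (ℤ.- (a /ℕ m)) (begin
      val ⟦ a ⟧ ℤ.- a
        ≡⟨ cong (λ r → + r ℤ.- a) (toℕ-fromℕ< (n%ℕd<d a m)) ⟩
      + (a %ℕ m) ℤ.- a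
        ≡⟨ cong (λ z → + (a %ℕ m) ℤ.- z) (a≡a%ℕn+[a/ℕn]*n a m) ⟩
      + (a %ℕ m) ℤ.- (+ (a %ℕ m) ℤ.+ (a /ℕ m) ℤ.* + m)
        ≡⟨ solve 3 (λ r q n → r :- (r :+ q :* n) := (:- q) :* n) refl (+ (a %ℕ m)) (a /ℕ m) (+ m) ⟩
      (ℤ.- (a /ℕ m)) ℤ.* + m ∎)
      where open ≡-Reasoning

    private
      ordered-residue-unique : ∀ {r s} → r ≤ s → s < m → m ∣ (s ℕ.∸ r) → r ≡ s
      ordered-residue-unique {r} {s} r≤s s<m m∣s-r with s ℕ.∸ r in eq
      ... | zero = ℕ.≤-antisym r≤s (ℕ.m∸n≡0⇒m≤n eq)
      ... | suc k = contradiction (ℕ.∣⇒≤ m∣s-r) (ℕ.<⇒≱ (ℕ.≤-<-trans (subst (ℕ._≤ s) eq (ℕ.m∸n≤m s r)) s<m))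

    residue-unique : ∀ {i j : Fin m} → + m ∣ᶻ val i ℤ.- val j → i ≡ j
    residue-unique {i} {j} m∣i-j with ℕ.≤-total (toℕ i) (toℕ j)
    ... | inj₁ i≤j = toℕ-injective (ordered-residue-unique i≤j (toℕ<n j)
            (subst (m ∣_) (trans (cong ℤ.∣_∣ (ℤ.[+m]-[+n]≡m⊖n (toℕ i) (toℕ j))) (ℤ.∣⊖∣-≤ i≤j)) (∣⇒∣ᵤ m∣i-j)))
    ... | inj₂ j≤i = toℕ-injective (sym (ordered-residue-unique j≤i (toℕ<n i)
            (subst (m ∣_) (trans (cong ℤ.∣_∣ (ℤ.[+m]-[+n]≡m⊖n (toℕ i) (toℕ j))) (cong ℤ.∣_∣ (ℤ.⊖-≥ j≤i))) (∣⇒∣ᵤ m∣i-j))))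

    ⟦⟧-cong : ∀ a b → + m ∣ᶻ a ℤ.- b → ⟦ a ⟧ ≡ ⟦ b ⟧
    ⟦⟧-cong a b m∣a-b = residue-unique (subst (+ m ∣ᶻ_)
      (solve 4 (λ a b a′ b′ → ((a′ :- a) :+ (a :- b)) :- (b′ :- b) := a′ :- b′) refl a b (val ⟦ a ⟧) (val ⟦ b ⟧))
      (∣m∣n⇒∣m-n (∣m∣n⇒∣m+n (m∣val⟦a⟧-a a) m∣a-b) (m∣val⟦a⟧-a b)))

    ⟦⟧-injective : ∀ a b → ⟦ a ⟧ ≡ ⟦ b ⟧ → + m ∣ᶻ a ℤ.- b
    ⟦⟧-injective a b eq = subst (+ m ∣ᶻ_)
      (trans (cong (λ i → (val ⟦ b ⟧ ℤ.- b) ℤ.- (val i ℤ.- a)) eq)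
        (solve 3 (λ a b c → (c :- b) :- (c :- a) := a :- b) refl a b (val ⟦ b ⟧)))
      (∣m∣n⇒∣m-n (m∣val⟦a⟧-a b) (m∣val⟦a⟧-a a))

    ⟦val⟧ : ∀ i → ⟦ val i ⟧ ≡ i
    ⟦val⟧ i = residue-unique (m∣val⟦a⟧-a (val i))

    _⊕_ : Fin m → Fin m → Fin m
    x ⊕ y = ⟦ val x ℤ.+ val y ⟧

    ⊖_ : Fin m → Fin m
    ⊖ x = ⟦ ℤ.- val x ⟧

    ⟦+⟧ : ∀ a b → ⟦ a ⟧ ⊕ ⟦ b ⟧ ≡ ⟦ a ℤ.+ b ⟧
    ⟦+⟧ a b = ⟦⟧-cong (val ⟦ a ⟧ ℤ.+ val ⟦ b ⟧) (a ℤ.+ b) (subst (+ m ∣ᶻ_)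
      (solve 4 (λ a b a′ b′ → (a′ :- a) :+ (b′ :- b) := (a′ :+ b′) :- (a :+ b)) refl a b (val ⟦ a ⟧) (val ⟦ b ⟧))
      (∣m∣n⇒∣m+n (m∣val⟦a⟧-a a) (m∣val⟦a⟧-a b)))

    ⟦-⟧ : ∀ a → ⊖ ⟦ a ⟧ ≡ ⟦ ℤ.- a ⟧
    ⟦-⟧ a = ⟦⟧-cong (ℤ.- val ⟦ a ⟧) (ℤ.- a) (subst (+ m ∣ᶻ_)
      (solve 2 (λ a a′ → :- (a′ :- a) := (:- a′) :- (:- a)) refl a (val ⟦ a ⟧)) (∣m⇒∣-m (m∣val⟦a⟧-a a)))

    -- Laws on `Fin m` thereby become laws of ℤ under the reduction `⟦_⟧`, with no computation on
    -- remainders.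
    ⟦⟧-surjective : (P : Fin m → Set) → (∀ a → P ⟦ a ⟧) → ∀ i → P i
    ⟦⟧-surjective P p i = subst P (⟦val⟧ i) (p (val i))

    ⊕-assoc : ∀ x y z → (x ⊕ y) ⊕ z ≡ x ⊕ (y ⊕ z)
    ⊕-assoc = ⟦⟧-surjective _ λ a → ⟦⟧-surjective _ λ b → ⟦⟧-surjective _ λ c → begin
      (⟦ a ⟧ ⊕ ⟦ b ⟧) ⊕ ⟦ c ⟧ ≡⟨ cong (_⊕ ⟦ c ⟧) (⟦+⟧ a b) ⟩
      ⟦ a ℤ.+ b ⟧ ⊕ ⟦ c ⟧     ≡⟨ ⟦+⟧ (a ℤ.+ b) c ⟩
      ⟦ a ℤ.+ b ℤ.+ c ⟧       ≡⟨ cong ⟦_⟧ (ℤ.+-assoc a b c) ⟩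
      ⟦ a ℤ.+ (b ℤ.+ c) ⟧     ≡⟨ ⟦+⟧ a (b ℤ.+ c) ⟨
      ⟦ a ⟧ ⊕ ⟦ b ℤ.+ c ⟧     ≡⟨ cong (⟦ a ⟧ ⊕_) (⟦+⟧ b c) ⟨
      ⟦ a ⟧ ⊕ (⟦ b ⟧ ⊕ ⟦ c ⟧) ∎
      where open ≡-Reasoning

    ⊕-comm : ∀ x y → x ⊕ y ≡ y ⊕ x
    ⊕-comm x y = cong ⟦_⟧ (ℤ.+-comm (val x) (val y))

    ⊕-identityˡ : ∀ x → ⟦ 0ℤ ⟧ ⊕ x ≡ x
    ⊕-identityˡ = ⟦⟧-surjective _ λ a → trans (⟦+⟧ 0ℤ a) (cong ⟦_⟧ (ℤ.+-identityˡ a))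

    ⊕-inverseˡ : ∀ x → (⊖ x) ⊕ x ≡ ⟦ 0ℤ ⟧
    ⊕-inverseˡ = ⟦⟧-surjective _ λ a →
      trans (cong (_⊕ ⟦ a ⟧) (⟦-⟧ a)) (trans (⟦+⟧ (ℤ.- a) a) (cong ⟦_⟧ (ℤ.+-inverseˡ a)))

    residues : FiniteAbelianGroup m
    residues = record
      { G = Fin m ; _+_ = _⊕_ ; 0# = ⟦ 0ℤ ⟧ ; -_ = ⊖_ ; enum = ↔-id (Fin m)
      ; isAbelianGroup = record
        { isGroup = record
          { isMonoid = record
            { isSemigroup = record
              { isMagma = record { isEquivalence = isEquivalence ; ∙-cong = cong₂ _⊕_ }
              ; assoc = ⊕-assoc }
            ; identity = ⊕-identityˡ , λ x → trans (⊕-comm x _) (⊕-identityˡ x) }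
          ; inverse = ⊕-inverseˡ , λ x → trans (⊕-comm x _) (⊕-inverseˡ x)
          ; ⁻¹-cong = cong ⊖_ }
        ; comm = ⊕-comm } }

    open Multiples (FiniteAbelianGroup.monoid residues) using () renaming (_×_ to _·_)

    multiple-⟦⟧ : ∀ q a → q · ⟦ a ⟧ ≡ ⟦ + q ℤ.* a ⟧
    multiple-⟦⟧ zero a = refl
    multiple-⟦⟧ (suc q) a = trans (cong (⟦ a ⟧ ⊕_) (multiple-⟦⟧ q a)) (trans (⟦+⟧ a (+ q ℤ.* a))
      (cong ⟦_⟧ (sym (ℤ.suc-* (+ q) a))))

open ModularArithmetic

-- Transversal designs: filling holes, products, linear forms

module TransversalDesigns where
  open import Data.Integer as ℤ using (ℤ; +_; 1ℤ)
  open import Data.Integer.Divisibility.Signed using (∣m∣n⇒∣m+n; ∣m∣n⇒∣m-n; ∣m⇒∣m*n) renaming (_∣_ to _∣ᶻ_)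
  import Data.Integer.Properties as ℤ
  open import Data.Integer.Solver using (module +-*-Solver)
  import Data.Sum.Properties as Sum

  open +-*-Solver using (solve; _:+_; _:*_; :-_; _:-_; _:=_; con)

  -- With k = 4 this is a pair of orthogonal Latin squares. Uniqueness concerns the points of a
  -- block rather than the block itself, so `Block` may list a block repeatedly, as ℤ × ℤ does for
  -- the linear designs.
  record TransversalDesign (k : ℕ) (W : Set) : Set₁ where
    field
      Block : Set
      pt : Block → Fin k → W
      line : ∀ {i j} → i ≢ j → ∀ p q → ∃ λ b → pt b i ≡ p × pt b j ≡ q
      agree : ∀ {i j} → i ≢ j → ∀ b b′ → pt b i ≡ pt b′ i → pt b j ≡ pt b′ j → ∀ l → pt b l ≡ pt b′ l

  -- A transversal design from which a subdesign on U has been removed.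
  record IncompleteTransversalDesign (k : ℕ) (A U : Set) : Set₁ where
    field
      Block : Set
      pt : Block → Fin k → A ⊎ U
      line : ∀ {i j} → i ≢ j → ∀ p q → (∀ u v → p ≡ inj₂ u → q ≡ inj₂ v → ⊥) → ∃ λ b → pt b i ≡ p × pt b j ≡ q
      agree : ∀ {i j} → i ≢ j → ∀ b b′ → pt b i ≡ pt b′ i → pt b j ≡ pt b′ j → ∀ l → pt b l ≡ pt b′ l
      hole : ∀ {i j} → i ≢ j → ∀ b u v → pt b i ≡ inj₂ u → pt b j ≡ inj₂ v → ⊥

  TD = TransversalDesign
  ITD = IncompleteTransversalDesign

  fill-hole : ∀ {k A U} → ITD k A U → TD k U → TD k (A ⊎ U)
  fill-hole {k} {A} {U} I D = record { Block = I.Block ⊎ D.Block ; pt = pt ; line = line ; agree = agree }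
    where
    module I = IncompleteTransversalDesign I
    module D = TransversalDesign D
    pt : I.Block ⊎ D.Block → Fin k → A ⊎ U
    pt (inj₁ b) = I.pt b
    pt (inj₂ b) = inj₂ ∘ D.pt b
    line : ∀ {i j} → i ≢ j → ∀ p q → ∃ λ b → pt b i ≡ p × pt b j ≡ q
    line i≢j (inj₁ x) q with I.line i≢j (inj₁ x) q (λ _ _ ())
    ... | b , eqs = inj₁ b , eqs
    line i≢j p@(inj₂ _) (inj₁ y) with I.line i≢j p (inj₁ y) (λ _ _ _ ())
    ... | b , eqs = inj₁ b , eqs
    line i≢j (inj₂ u) (inj₂ v) with D.line i≢j u v
    ... | b , eqᵢ , eqⱼ = inj₂ b , cong inj₂ eqᵢ , cong inj₂ eqⱼ
    agree : ∀ {i j} → i ≢ j → ∀ b b′ → pt b i ≡ pt b′ i → pt b j ≡ pt b′ j → ∀ l → pt b l ≡ pt b′ l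
    agree i≢j (inj₁ b) (inj₁ b′) eqᵢ eqⱼ = I.agree i≢j b b′ eqᵢ eqⱼ
    -- A block of D lies entirely in the hole, whereas a block of I meets it at most once.
    agree i≢j (inj₁ b) (inj₂ b′) eqᵢ eqⱼ = ⊥-elim (I.hole i≢j b _ _ eqᵢ eqⱼ)
    agree i≢j (inj₂ b) (inj₁ b′) eqᵢ eqⱼ = ⊥-elim (I.hole i≢j b′ _ _ (sym eqᵢ) (sym eqⱼ))
    agree i≢j (inj₂ b) (inj₂ b′) eqᵢ eqⱼ l =
      cong inj₂ (D.agree i≢j b b′ (Sum.inj₂-injective eqᵢ) (Sum.inj₂-injective eqⱼ) l)

  transport-TD : ∀ {k A B} → A ↔ B → TD k A → TD k B
  transport-TD e D = record
    { Block = D.Block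
    ; pt = λ b i → to e (D.pt b i)
    ; line = λ i≢j p q → let b , eqᵢ , eqⱼ = D.line i≢j (from e p) (from e q) in
        b , trans (cong (to e) eqᵢ) (strictlyInverseˡ e p) , trans (cong (to e) eqⱼ) (strictlyInverseˡ e q)
    ; agree = λ i≢j b b′ eqᵢ eqⱼ l → cong (to e) (D.agree i≢j b b′ (to-injective e eqᵢ) (to-injective e eqⱼ) l)
    }
    where module D = TransversalDesign D

  -- MacNeish's direct product.
  product-TD : ∀ {k A B} → TD k A → TD k B → TD k (A × B)
  product-TD D E = record
    { Block = D.Block × E.Block
    ; pt = λ (b , c) i → D.pt b i , E.pt c i
    ; line = λ i≢j (p , p′) (q , q′) →
        let b , eqᵢ , eqⱼ = D.line i≢j p q
            c , eqᵢ′ , eqⱼ′ = E.line i≢j p′ q′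
        in (b , c) , cong₂ _,_ eqᵢ eqᵢ′ , cong₂ _,_ eqⱼ eqⱼ′
    ; agree = λ i≢j (b , c) (b′ , c′) eqᵢ eqⱼ l → cong₂ _,_
        (D.agree i≢j b b′ (cong proj₁ eqᵢ) (cong proj₁ eqⱼ) l)
        (E.agree i≢j c c′ (cong proj₂ eqᵢ) (cong proj₂ eqⱼ) l)
    }
    where
    module D = TransversalDesign D
    module E = TransversalDesign E

  module Linear (t : ℕ) .{{_ : NonZero t}} {k : ℕ} (α β : Fin k → ℤ) where
    open Residues t

    det : Fin k → Fin k → ℤ
    det i j = α i ℤ.* β j ℤ.- α j ℤ.* β i

    -- Two linear forms whose determinant is a unit modulo t take each pair of values at exactly one
    -- (a , b) modulo t; e is the inverse of the determinant.
    linear-TD : (∀ {i j} → i ≢ j → ∃ λ e → + t ∣ᶻ e ℤ.* det i j ℤ.- 1ℤ) → TD k (Fin t)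
    linear-TD unit = record { Block = ℤ × ℤ ; pt = pt ; line = line ; agree = agree }
      where
      pt : ℤ × ℤ → Fin k → Fin t
      pt (a , b) i = ⟦ α i ℤ.* a ℤ.+ β i ℤ.* b ⟧

      line : ∀ {i j} → i ≢ j → ∀ p q → ∃ λ b → pt b i ≡ p × pt b j ≡ q
      line {i} {j} i≢j p q = (a , b) , trans (⟦⟧-cong (α i ℤ.* a ℤ.+ β i ℤ.* b) (val p) atᵢ) (⟦val⟧ p)
                           , trans (⟦⟧-cong (α j ℤ.* a ℤ.+ β j ℤ.* b) (val q) atⱼ) (⟦val⟧ q)
        where
        e = proj₁ (unit i≢j)
        -- Cramer's rule.
        a = e ℤ.* (val p ℤ.* β j ℤ.- val q ℤ.* β i)
        b = e ℤ.* (α i ℤ.* val q ℤ.- α j ℤ.* val p)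
        atᵢ : + t ∣ᶻ (α i ℤ.* a ℤ.+ β i ℤ.* b) ℤ.- val p
        atᵢ = subst (+ t ∣ᶻ_) (solve 7 (λ e x y x′ y′ p q →
            (e :* (x :* y′ :- x′ :* y) :- con 1ℤ) :* p :=
            (x :* (e :* (p :* y′ :- q :* y)) :+ y :* (e :* (x :* q :- x′ :* p))) :- p)
            refl e (α i) (β i) (α j) (β j) (val p) (val q))
          (∣m⇒∣m*n (val p) (proj₂ (unit i≢j)))
        atⱼ : + t ∣ᶻ (α j ℤ.* a ℤ.+ β j ℤ.* b) ℤ.- val q
        atⱼ = subst (+ t ∣ᶻ_) (solve 7 (λ e x y x′ y′ p q →
            (e :* (x :* y′ :- x′ :* y) :- con 1ℤ) :* q :=
            (x′ :* (e :* (p :* y′ :- q :* y)) :+ y′ :* (e :* (x :* q :- x′ :* p))) :- q)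
            refl e (α i) (β i) (α j) (β j) (val p) (val q))
          (∣m⇒∣m*n (val q) (proj₂ (unit i≢j)))

      agree : ∀ {i j} → i ≢ j → ∀ b b′ → pt b i ≡ pt b′ i → pt b j ≡ pt b′ j → ∀ l → pt b l ≡ pt b′ l
      agree {i} {j} i≢j (a , b) (a′ , b′) eqᵢ eqⱼ l =
        ⟦⟧-cong (α l ℤ.* a ℤ.+ β l ℤ.* b) (α l ℤ.* a′ ℤ.+ β l ℤ.* b′) (subst (+ t ∣ᶻ_)
          -- The Plücker relation: det i j times form l equals det l j times form i plus det i l
          -- times form j.
          (solve 11 (λ e x y x′ y′ x″ y″ a b a′ b′ →
              ((x :* a :+ y :* b) :- (x :* a′ :+ y :* b′)) :* (e :* (x″ :* y′ :- x′ :* y″))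
              :+ ((x′ :* a :+ y′ :* b) :- (x′ :* a′ :+ y′ :* b′)) :* (e :* (x :* y″ :- x″ :* y))
              :- (e :* (x :* y′ :- x′ :* y) :- con 1ℤ) :* (x″ :* (a :- a′) :+ y″ :* (b :- b′))
              := (x″ :* a :+ y″ :* b) :- (x″ :* a′ :+ y″ :* b′))
            refl e (α i) (β i) (α j) (β j) (α l) (β l) a b a′ b′)
          (∣m∣n⇒∣m-n (∣m∣n⇒∣m+n
              (∣m⇒∣m*n (e ℤ.* det l j) (⟦⟧-injective (α i ℤ.* a ℤ.+ β i ℤ.* b) (α i ℤ.* a′ ℤ.+ β i ℤ.* b′) eqᵢ))
              (∣m⇒∣m*n (e ℤ.* det i l) (⟦⟧-injective (α j ℤ.* a ℤ.+ β j ℤ.* b) (α j ℤ.* a′ ℤ.+ β j ℤ.* b′) eqⱼ)))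
            (∣m⇒∣m*n (α l ℤ.* (a ℤ.- a′) ℤ.+ β l ℤ.* (b ℤ.- b′)) (proj₂ (unit i≢j)))))
        where
        e = proj₁ (unit i≢j)

open TransversalDesigns

-- Small designs developed from tables over ℤ_n

module QuasiDifferenceMatrices where
  import Algebra.Properties.AbelianGroup as AbelianGroupProperties
  open import Data.Fin.Properties using (all?; any?) renaming (_≟_ to _≟ᶠ_)
  open import Data.Maybe using (Maybe; just; nothing)
  import Data.Maybe.Properties as Maybe
  open import Data.Nat.DivMod using (_mod_)
  import Data.Sum.Properties as Sum
  open import Data.Vec using (Vec; []; _∷_; lookup; _++_)
  open import Relation.Nullary.Decidable using (_→-dec_; _×-dec_; toWitness; True)
  open import Relation.Binary using (DecidableEquality)

  module QuasiDifferenceMatrix (n u : ℕ) .{{_ : NonZero n}} where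
    open Residues n
    open FiniteAbelianGroup residues
      using (_+_; -_; 0#; abelianGroup; +-assoc; +-comm; +-inverseˡ; +-inverseʳ; +-identityˡ; +-identityʳ; +-cancelʳ; +-interchange)
    open AbelianGroupProperties abelianGroup using (⁻¹-∙-comm; ⁻¹-anti-homo‿-)

    Point : Set
    Point = Fin n ⊎ Fin u

    shift : Fin n → Point → Point
    shift g = map₁ (g +_)

    -- The orbits of pairs of points under translation, except for the pairs in the hole.
    Kind : Set
    Kind = Maybe (Fin n ⊎ (Fin u ⊎ Fin u))

    kind : Point → Point → Kind
    kind (inj₁ x) (inj₁ y) = just (inj₁ (x + (- y)))
    kind (inj₁ _) (inj₂ v) = just (inj₂ (inj₁ v))
    kind (inj₂ v) (inj₁ _) = just (inj₂ (inj₂ v))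
    kind (inj₂ _) (inj₂ _) = nothing

    _≟_ : DecidableEquality Kind
    _≟_ = Maybe.≡-dec (Sum.≡-dec _≟ᶠ_ (Sum.≡-dec _≟ᶠ_ _≟ᶠ_))

    -- Each orbit outside the hole is hit by exactly one column, so there are n + 2u columns: n
    -- differences, and u points at infinity on either side. All quantifiers are finite, and a table
    -- is verified by evaluation.
    IsQDM : ∀ {c k} → (Fin c → Fin k → Point) → Set
    IsQDM {c} {k} col = ∀ i j → i ≢ j →
      (∀ δ → ∃ λ x → kind (col x i) (col x j) ≡ just (inj₁ δ)) ×
      (∀ v → ∃ λ x → kind (col x i) (col x j) ≡ just (inj₂ (inj₁ v))) ×
      (∀ v → ∃ λ x → kind (col x i) (col x j) ≡ just (inj₂ (inj₂ v))) ×
      (∀ x → kind (col x i) (col x j) ≢ nothing) ×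
      (∀ x y → kind (col x i) (col x j) ≡ kind (col y i) (col y j) → x ≡ y)

    isQDM? : ∀ {c k} (col : Fin c → Fin k → Point) → Dec (IsQDM col)
    isQDM? col = all? λ i → all? λ j → ¬? (i ≟ᶠ j) →-dec
      (all? λ δ → any? λ x → kind (col x i) (col x j) ≟ just (inj₁ δ)) ×-dec
      (all? λ v → any? λ x → kind (col x i) (col x j) ≟ just (inj₂ (inj₁ v))) ×-dec
      (all? λ v → any? λ x → kind (col x i) (col x j) ≟ just (inj₂ (inj₂ v))) ×-dec
      (all? λ x → ¬? (kind (col x i) (col x j) ≟ nothing)) ×-dec
      (all? λ x → all? λ y → (kind (col x i) (col x j) ≟ kind (col y i) (col y j)) →-dec (x ≟ᶠ y))

    cancel : ∀ g x y → (g + x) + (- (g + y)) ≡ x + (- y)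
    cancel g x y = begin
        (g + x) + (- (g + y))       ≡⟨ cong ((g + x) +_) (⁻¹-∙-comm g y) ⟨
        (g + x) + ((- g) + (- y))   ≡⟨ +-interchange g x (- g) (- y) ⟩
        (g + (- g)) + (x + (- y))   ≡⟨ cong (_+ (x + (- y))) (+-inverseʳ g) ⟩
        0# + (x + (- y))            ≡⟨ +-identityˡ _ ⟩
        x + (- y)                   ∎
      where open ≡-Reasoning

    kind-shift : ∀ g p q → kind (shift g p) (shift g q) ≡ kind p q
    kind-shift g (inj₁ x) (inj₁ y) = cong (just ∘ inj₁) (cancel g x y)
    kind-shift g (inj₁ _) (inj₂ _) = refl
    kind-shift g (inj₂ _) (inj₁ _) = refl
    kind-shift g (inj₂ _) (inj₂ _) = refl

    move : ∀ x y → (y + (- x)) + x ≡ y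
    move x y = trans (+-assoc _ _ _) (trans (cong (y +_) (+-inverseˡ x)) (+-identityʳ y))

    shift-to : ∀ p q p′ q′ → kind p q ≡ kind p′ q′ → kind p q ≢ nothing → ∃ λ g → shift g p ≡ p′ × shift g q ≡ q′
    shift-to (inj₁ x) (inj₁ y) (inj₁ x′) (inj₁ y′) eq _ = x′ + (- x) , cong inj₁ (move x x′) , cong inj₁ (begin
        (x′ + (- x)) + y                  ≡⟨ cong ((x′ + (- x)) +_) (move-diff x y) ⟨
        (x′ + (- x)) + (x + (- (x + (- y)))) ≡⟨ +-assoc _ x _ ⟨
        ((x′ + (- x)) + x) + (- (x + (- y))) ≡⟨ cong₂ (λ a b → a + (- b)) (move x x′) diff ⟩
        x′ + (- (x′ + (- y′)))            ≡⟨ move-diff x′ y′ ⟩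
        y′ ∎)
      where
      open ≡-Reasoning
      diff : x + (- y) ≡ x′ + (- y′)
      diff = Sum.inj₁-injective (Maybe.just-injective eq)
      move-diff : ∀ a b → a + (- (a + (- b))) ≡ b
      move-diff a b = trans (cong (a +_) (⁻¹-anti-homo‿- a b)) (trans (+-comm a _) (move a b))
    shift-to (inj₁ x) (inj₂ v) (inj₁ x′) (inj₂ .v) refl _ = x′ + (- x) , cong inj₁ (move x x′) , refl
    shift-to (inj₂ v) (inj₁ y) (inj₂ .v) (inj₁ y′) refl _ = y′ + (- y) , refl , cong inj₁ (move y y′)
    shift-to (inj₁ _) (inj₁ _) (inj₁ _) (inj₂ _) () _
    shift-to (inj₁ _) (inj₁ _) (inj₂ _) (inj₁ _) () _
    shift-to (inj₁ _) (inj₁ _) (inj₂ _) (inj₂ _) () _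
    shift-to (inj₁ _) (inj₂ _) (inj₁ _) (inj₁ _) () _
    shift-to (inj₁ _) (inj₂ _) (inj₂ _) (inj₁ _) () _
    shift-to (inj₁ _) (inj₂ _) (inj₂ _) (inj₂ _) () _
    shift-to (inj₂ _) (inj₁ _) (inj₁ _) (inj₁ _) () _
    shift-to (inj₂ _) (inj₁ _) (inj₁ _) (inj₂ _) () _
    shift-to (inj₂ _) (inj₁ _) (inj₂ _) (inj₂ _) () _
    shift-to (inj₂ _) (inj₂ _) _ _ _ ≢nothing = ⊥-elim (≢nothing refl)

    -- Points at infinity are fixed by every translation; one finite point in the pair is what makes
    -- the action free.
    shift-unique : ∀ g g′ p q → kind p q ≢ nothing → shift g p ≡ shift g′ p → shift g q ≡ shift g′ q → g ≡ g′
    shift-unique g g′ (inj₁ x) _ _ eq _ = +-cancelʳ x g g′ (Sum.inj₁-injective eq)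
    shift-unique g g′ (inj₂ _) (inj₁ y) _ _ eq = +-cancelʳ y g g′ (Sum.inj₁-injective eq)
    shift-unique g g′ (inj₂ _) (inj₂ _) ≢nothing _ _ = ⊥-elim (≢nothing refl)

    -- A pair outside the hole lies in one orbit, one column hits this orbit, and since translations
    -- act freely a single translate of the column passes through the pair.
    QDM⇒ITD : ∀ {c k} (col : Fin c → Fin k → Point) → IsQDM col → ITD k (Fin n) (Fin u)
    QDM⇒ITD {c} {k} col isQDM = record { Block = Fin c × Fin n ; pt = pt ; line = line ; agree = agree ; hole = hole }
      where
      pt : Fin c × Fin n → Fin k → Point
      pt (x , g) i = shift g (col x i)

      column : ∀ {i j} → i ≢ j → ∀ p q → (∀ u v → p ≡ inj₂ u → q ≡ inj₂ v → ⊥) → ∃ λ x → kind (col x i) (col x j) ≡ kind p q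
      column {i} {j} i≢j (inj₁ x) (inj₁ y) _ = let exists , _ = isQDM i j i≢j in exists (x + (- y))
      column {i} {j} i≢j (inj₁ _) (inj₂ v) _ = let _ , exists , _ = isQDM i j i≢j in exists v
      column {i} {j} i≢j (inj₂ v) (inj₁ _) _ = let _ , _ , exists , _ = isQDM i j i≢j in exists v
      column i≢j (inj₂ u) (inj₂ v) ¬hole = ⊥-elim (¬hole u v refl refl)

      no-hole : ∀ {i j} → i ≢ j → ∀ x → kind (col x i) (col x j) ≢ nothing
      no-hole {i} {j} i≢j = let _ , _ , _ , ≢nothing , _ = isQDM i j i≢j in ≢nothing

      line : ∀ {i j} → i ≢ j → ∀ p q → (∀ u v → p ≡ inj₂ u → q ≡ inj₂ v → ⊥) → ∃ λ b → pt b i ≡ p × pt b j ≡ q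
      line {i} {j} i≢j p q ¬hole =
        let x , eq = column i≢j p q ¬hole
            g , eqs = shift-to (col x i) (col x j) p q eq (no-hole i≢j x)
        in (x , g) , eqs

      agree : ∀ {i j} → i ≢ j → ∀ b b′ → pt b i ≡ pt b′ i → pt b j ≡ pt b′ j → ∀ l → pt b l ≡ pt b′ l
      agree {i} {j} i≢j (x , g) (x′ , g′) eqᵢ eqⱼ l with
        proj₂ (proj₂ (proj₂ (proj₂ (isQDM i j i≢j)))) x x′
          (trans (sym (kind-shift g (col x i) (col x j))) (trans (cong₂ kind eqᵢ eqⱼ) (kind-shift g′ (col x′ i) (col x′ j))))
      ... | refl = cong (λ g → shift g (col x l)) (shift-unique g g′ (col x i) (col x j) (no-hole i≢j x) eqᵢ eqⱼ)

      hole : ∀ {i j} → i ≢ j → ∀ b u v → pt b i ≡ inj₂ u → pt b j ≡ inj₂ v → ⊥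
      hole {i} {j} i≢j (x , g) u v eqᵢ eqⱼ =
        no-hole i≢j x (trans (sym (kind-shift g (col x i) (col x j))) (cong₂ kind eqᵢ eqⱼ))

    columns : ∀ {c k} .{{_ : NonZero (n ℕ.+ u)}} → Vec (Vec ℕ k) c → Fin c → Fin k → Point
    columns table x i = splitAt n (lookup (lookup table x) i mod (n ℕ.+ u))

    table⇒ITD : ∀ {c k} .{{_ : NonZero (n ℕ.+ u)}} (table : Vec (Vec ℕ k) c) → {True (isQDM? (columns table))} → ITD k (Fin n) (Fin u)
    table⇒ITD table {isQDM} = QDM⇒ITD (columns table) (toWitness isQDM)

  -- The entry n + i of a table stands for the i-th point at infinity.
  ITD-3-1 : ITD 4 (Fin 3) (Fin 1)
  ITD-3-1 = QuasiDifferenceMatrix.table⇒ITD 3 1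
    ( (0 ∷ 0 ∷ 0 ∷ 0 ∷ []) ∷ (3 ∷ 0 ∷ 1 ∷ 2 ∷ []) ∷ (0 ∷ 3 ∷ 2 ∷ 1 ∷ []) ∷ (0 ∷ 1 ∷ 3 ∷ 2 ∷ []) ∷ (0 ∷ 2 ∷ 1 ∷ 3 ∷ []) ∷ [])

  ITD-7-1 : ITD 4 (Fin 7) (Fin 1)
  ITD-7-1 = QuasiDifferenceMatrix.table⇒ITD 7 1
    ( (0 ∷ 0 ∷ 0 ∷ 0 ∷ []) ∷ (7 ∷ 0 ∷ 1 ∷ 2 ∷ []) ∷ (0 ∷ 7 ∷ 3 ∷ 6 ∷ []) ∷ (0 ∷ 2 ∷ 7 ∷ 3 ∷ []) ∷ (0 ∷ 4 ∷ 2 ∷ 7 ∷ [])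
    ∷ (0 ∷ 1 ∷ 5 ∷ 4 ∷ []) ∷ (0 ∷ 3 ∷ 6 ∷ 1 ∷ []) ∷ (0 ∷ 5 ∷ 4 ∷ 2 ∷ []) ∷ (0 ∷ 6 ∷ 1 ∷ 5 ∷ []) ∷ [])

  -- In a table closed under rotation the condition on rows i and j depends only on j - i modulo 4.
  rotations : ℕ → ℕ → ℕ → ℕ → Vec (Vec ℕ 4) 4
  rotations a b c d = (a ∷ b ∷ c ∷ d ∷ []) ∷ (d ∷ a ∷ b ∷ c ∷ []) ∷ (c ∷ d ∷ a ∷ b ∷ []) ∷ (b ∷ c ∷ d ∷ a ∷ []) ∷ []

  -- The finite entries 0, 1, 4 of the first starter are multiplied by 2 and by 4 modulo 7 in the
  -- other two.
  ITD-7-3 : ITD 4 (Fin 7) (Fin 3)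
  ITD-7-3 = QuasiDifferenceMatrix.table⇒ITD 7 3
    ((0 ∷ 0 ∷ 0 ∷ 0 ∷ []) ∷ rotations 7 0 1 4 ++ rotations 8 0 2 1 ++ rotations 9 0 4 2)

  ITD-11-3 : ITD 4 (Fin 11) (Fin 3)
  ITD-11-3 = QuasiDifferenceMatrix.table⇒ITD 11 3
    ((0 ∷ 0 ∷ 0 ∷ 0 ∷ []) ∷ rotations 0 1 4 6 ++ rotations 11 0 4 1 ++ rotations 12 0 6 2 ++ rotations 13 0 9 8)

open QuasiDifferenceMatrices

-- Wilson's construction and its ingredients

module WilsonConstruction where
  open import Data.Fin.Properties using (all?; +↔⊎; *↔×; inject₁-injective; fromℕ≢inject₁) renaming (_≟_ to _≟ᶠ_)
  open import Data.Integer as ℤ using (ℤ; +_; -[1+_]; 0ℤ; 1ℤ)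
  open import Data.Integer.Divisibility.Signed using (divides) renaming (_∣_ to _∣ᶻ_)
  import Data.Integer.Properties as ℤ
  open import Data.Integer.Solver using (module +-*-Solver)
  import Data.Sum.Properties as Sum
  open import Data.Unit using (tt)
  open import Relation.Nullary.Decidable using (_→-dec_; toWitness)

  open +-*-Solver using (solve; _:+_; _:*_; :-_; _:-_; _:=_; con)

  -- Wilson's construction: give weight |A| to every point of the first k groups of D, and
  -- truncate its last group T to U.
  module Wilson {k : ℕ} {T U R A : Set} (δ : T ↔ (U ⊎ R))
    (D : TD (suc k) T) (E : TD k A) (I : ITD k A (Fin 1)) where
    module D = TransversalDesign D
    module E = TransversalDesign E
    module I = IncompleteTransversalDesign I

    -- A block of D ending at a kept point z is replaced by a design on A with one extra point,
    -- which becomes z; a block ending at a deleted point by a design on A alone.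
    Sub : U ⊎ R → Set
    Sub (inj₁ _) = I.Block
    Sub (inj₂ _) = E.Block

    sub-pt : ∀ s → Sub s → Fin k → A ⊎ U
    sub-pt (inj₁ z) b = map₂ (const z) ∘ I.pt b
    sub-pt (inj₂ _) b = inj₁ ∘ E.pt b

    map₂-inj₂ : ∀ {z : U} (p : A ⊎ Fin 1) {v} → map₂ (const z) p ≡ inj₂ v → p ≡ inj₂ zero × z ≡ v
    map₂-inj₂ (inj₂ zero) refl = refl , refl

    map₂-injective : ∀ {z : U} (p q : A ⊎ Fin 1) → map₂ (const z) p ≡ map₂ (const z) q → p ≡ q
    map₂-injective (inj₁ _) (inj₁ _) refl = refl
    map₂-injective (inj₂ zero) (inj₂ zero) _ = refl

    sub-line : ∀ {i j} → i ≢ j → ∀ s x y → ∃ λ b → sub-pt s b i ≡ inj₁ x × sub-pt s b j ≡ inj₁ y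
    sub-line i≢j (inj₁ z) x y =
      let b , eqᵢ , eqⱼ = I.line i≢j (inj₁ x) (inj₁ y) (λ _ _ ())
      in b , cong (map₂ (const z)) eqᵢ , cong (map₂ (const z)) eqⱼ
    sub-line i≢j (inj₂ _) x y = let b , eqᵢ , eqⱼ = E.line i≢j x y in b , cong inj₁ eqᵢ , cong inj₁ eqⱼ

    -- At the call s is `last b`, known to be the kept point z only up to an equation, so the
    -- equation is an argument.
    sub-line-∞ : ∀ {i j} → i ≢ j → ∀ s z x → s ≡ inj₁ z → ∃ λ b → sub-pt s b i ≡ inj₁ x × sub-pt s b j ≡ inj₂ z
    sub-line-∞ i≢j _ z x refl =
      let b , eqᵢ , eqⱼ = I.line i≢j (inj₁ x) (inj₂ zero) (λ _ _ ())
      in b , cong (map₂ (const z)) eqᵢ , cong (map₂ (const z)) eqⱼ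

    sub-agree : ∀ {i j} → i ≢ j → ∀ s s′ → s ≡ s′ → (b : Sub s) (b′ : Sub s′) →
      sub-pt s b i ≡ sub-pt s′ b′ i → sub-pt s b j ≡ sub-pt s′ b′ j → ∀ l → sub-pt s b l ≡ sub-pt s′ b′ l
    sub-agree i≢j (inj₁ z) _ refl b b′ eqᵢ eqⱼ l =
      cong (map₂ (const z)) (I.agree i≢j b b′ (map₂-injective _ _ eqᵢ) (map₂-injective _ _ eqⱼ) l)
    sub-agree i≢j (inj₂ _) _ refl b b′ eqᵢ eqⱼ l =
      cong inj₁ (E.agree i≢j b b′ (Sum.inj₁-injective eqᵢ) (Sum.inj₁-injective eqⱼ) l)

    sub-hole : ∀ {i j} → i ≢ j → ∀ s (b : Sub s) u v → sub-pt s b i ≡ inj₂ u → sub-pt s b j ≡ inj₂ v → ⊥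
    sub-hole {i} {j} i≢j (inj₁ z) b u v eqᵢ eqⱼ =
      I.hole i≢j b zero zero (proj₁ (map₂-inj₂ (I.pt b i) eqᵢ)) (proj₁ (map₂-inj₂ (I.pt b j) eqⱼ))

    sub-∞ : ∀ s (b : Sub s) i v → sub-pt s b i ≡ inj₂ v → s ≡ inj₁ v
    sub-∞ (inj₁ z) b i v eq = cong inj₁ (proj₂ (map₂-inj₂ (I.pt b i) eq))

    last : D.Block → U ⊎ R
    last b = to δ (D.pt b (fromℕ k))

    pt : Σ D.Block (Sub ∘ last) → Fin k → (T × A) ⊎ U
    pt (b , c) i = map₁ (D.pt b (inject₁ i) ,_) (sub-pt (last b) c i)

    map₁-inj₁ : ∀ {x : T} (p : A ⊎ U) {y a} → map₁ (x ,_) p ≡ inj₁ (y , a) → x ≡ y × p ≡ inj₁ a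
    map₁-inj₁ (inj₁ _) refl = refl , refl

    map₁-inj₂ : ∀ {x : T} (p : A ⊎ U) {v} → map₁ (x ,_) p ≡ inj₂ v → p ≡ inj₂ v
    map₁-inj₂ (inj₂ _) refl = refl

    inject₁-≢ : ∀ {i j : Fin k} → i ≢ j → inject₁ i ≢ inject₁ j
    inject₁-≢ i≢j eq = i≢j (inject₁-injective eq)

    line-∞ : ∀ {i j} → i ≢ j → ∀ x a z → ∃ λ b → pt b i ≡ inj₁ (x , a) × pt b j ≡ inj₂ z
    line-∞ {i} {j} i≢j x a z =
      let b , eqᵢ , eq∞ = D.line (fromℕ≢inject₁ ∘ sym) x (from δ (inj₁ z))
          c , eqᵢ′ , eqⱼ′ = sub-line-∞ i≢j (last b) z a (trans (cong (to δ) eq∞) (strictlyInverseˡ δ _))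
      in (b , c) , trans (cong (map₁ _) eqᵢ′) (cong (λ x → inj₁ (x , a)) eqᵢ) , cong (map₁ _) eqⱼ′

    line : ∀ {i j} → i ≢ j → ∀ p q → (∀ u v → p ≡ inj₂ u → q ≡ inj₂ v → ⊥) → ∃ λ b → pt b i ≡ p × pt b j ≡ q
    line i≢j (inj₁ (x , a)) (inj₁ (y , a′)) _ =
      let b , eqᵢ , eqⱼ = D.line (inject₁-≢ i≢j) x y
          c , eqᵢ′ , eqⱼ′ = sub-line i≢j (last b) a a′
      in (b , c) , trans (cong (map₁ _) eqᵢ′) (cong (λ x → inj₁ (x , a)) eqᵢ)
                 , trans (cong (map₁ _) eqⱼ′) (cong (λ x → inj₁ (x , a′)) eqⱼ)
    line i≢j (inj₁ (x , a)) (inj₂ z) _ = line-∞ i≢j x a z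
    line i≢j (inj₂ z) (inj₁ (y , a)) _ = let b , eqⱼ , eqᵢ = line-∞ (i≢j ∘ sym) y a z in b , eqᵢ , eqⱼ
    line i≢j (inj₂ u) (inj₂ v) ¬hole = ⊥-elim (¬hole u v refl refl)

    hole : ∀ {i j} → i ≢ j → ∀ b u v → pt b i ≡ inj₂ u → pt b j ≡ inj₂ v → ⊥
    hole {i} {j} i≢j (b , c) u v eqᵢ eqⱼ =
      sub-hole i≢j (last b) c u v (map₁-inj₂ _ eqᵢ) (map₁-inj₂ _ eqⱼ)

    agree-from : ∀ {i j} → i ≢ j → ∀ b b′ → (∀ l → D.pt (proj₁ b) l ≡ D.pt (proj₁ b′) l) →
      sub-pt (last (proj₁ b)) (proj₂ b) i ≡ sub-pt (last (proj₁ b′)) (proj₂ b′) i →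
      sub-pt (last (proj₁ b)) (proj₂ b) j ≡ sub-pt (last (proj₁ b′)) (proj₂ b′) j → ∀ l → pt b l ≡ pt b′ l
    agree-from i≢j (b , c) (b′ , c′) eq eqᵢ eqⱼ l =
      cong₂ (λ x p → map₁ (x ,_) p) (eq (inject₁ l))
        (sub-agree i≢j (last b) (last b′) (cong (to δ) (eq (fromℕ k))) c c′ eqᵢ eqⱼ l)

    -- A point z of U reveals the last point of the underlying block of D, and together with the
    -- T-part of x this determines that block.
    agree-∞ : ∀ {i j} → i ≢ j → ∀ b b′ x z → pt b i ≡ inj₁ x → pt b′ i ≡ inj₁ x → pt b j ≡ inj₂ z → pt b′ j ≡ inj₂ z →
      ∀ l → pt b l ≡ pt b′ l
    agree-∞ {i} {j} i≢j B@(b , c) B′@(b′ , c′) x z eqᵢ eqᵢ′ eqⱼ eqⱼ′ =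
      let eqT , eqA = map₁-inj₁ _ eqᵢ
          eqT′ , eqA′ = map₁-inj₁ _ eqᵢ′
          last-b = sub-∞ (last b) c j z (map₁-inj₂ _ eqⱼ)
          last-b′ = sub-∞ (last b′) c′ j z (map₁-inj₂ _ eqⱼ′)
      in agree-from i≢j B B′
           (D.agree (fromℕ≢inject₁ ∘ sym) b b′ (trans eqT (sym eqT′)) (to-injective δ (trans last-b (sym last-b′))))
           (trans eqA (sym eqA′)) (trans (map₁-inj₂ _ eqⱼ) (sym (map₁-inj₂ _ eqⱼ′)))

    agree : ∀ {i j} → i ≢ j → ∀ b b′ → pt b i ≡ pt b′ i → pt b j ≡ pt b′ j → ∀ l → pt b l ≡ pt b′ l
    agree {i} {j} i≢j B@(b , c) B′@(b′ , c′) eqᵢ eqⱼ with pt B′ i in atᵢ | pt B′ j in atⱼ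
    ... | inj₁ (x , a) | inj₁ (y , a′) =
      let eqT , eqA = map₁-inj₁ _ eqᵢ
          eqT′ , eqA′ = map₁-inj₁ _ atᵢ
          eqT₁ , eqA₁ = map₁-inj₁ _ eqⱼ
          eqT₁′ , eqA₁′ = map₁-inj₁ _ atⱼ
      in agree-from i≢j B B′ (D.agree (inject₁-≢ i≢j) b b′ (trans eqT (sym eqT′)) (trans eqT₁ (sym eqT₁′)))
           (trans eqA (sym eqA′)) (trans eqA₁ (sym eqA₁′))
    ... | inj₁ x | inj₂ z = agree-∞ i≢j B B′ x z eqᵢ atᵢ eqⱼ atⱼ
    ... | inj₂ z | inj₁ y = agree-∞ (i≢j ∘ sym) B B′ y z eqⱼ atⱼ eqᵢ atᵢ
    ... | inj₂ u | inj₂ v = ⊥-elim (hole i≢j B u v eqᵢ eqⱼ)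

    wilson-ITD : ITD k (T × A) U
    wilson-ITD = record { Block = Σ D.Block (Sub ∘ last) ; pt = pt ; line = line ; agree = agree ; hole = hole }

  HasTD : ℕ → Set₁
  HasTD w = TD 4 (Fin w)

  cast-HasTD : ∀ {v w} → v ≡ w → HasTD v → HasTD w
  cast-HasTD refl D = D

  product-HasTD : ∀ {v w} → HasTD v → HasTD w → HasTD (v ℕ.* w)
  product-HasTD D E = transport-TD (↔-sym *↔×) (product-TD D E)

  fill-HasTD : ∀ {a u} → ITD 4 (Fin a) (Fin u) → HasTD u → HasTD (a ℕ.+ u)
  fill-HasTD I D = transport-TD (↔-sym +↔⊎) (fill-hole I D)

  -- Over Z_t, the linear forms a + b·c (c = 0 … d) and b.
  slope-α slope-β : ∀ {d} → Fin (suc (suc d)) → ℤ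
  slope-α zero = 0ℤ
  slope-α (suc _) = 1ℤ
  slope-β zero = 1ℤ
  slope-β (suc c) = + toℕ c

  module _ (t : ℕ) .{{_ : NonZero t}} where
    -- The determinants are ±1 and the differences of slopes. If N is a common multiple of them and
    -- a unit modulo t, all are units: f gives N divided by the determinant, and e inverts N.
    slopes-TD : ∀ d (N e : ℤ) (f : ℤ → ℤ) → + t ∣ᶻ e ℤ.* N ℤ.- 1ℤ →
      (∀ i j → i ≢ j → f (Linear.det t {suc (suc d)} slope-α slope-β i j) ℤ.* Linear.det t {suc (suc d)} slope-α slope-β i j ≡ N) →
      TD (suc (suc d)) (Fin t)
    slopes-TD d N e f unit cofactor = Linear.linear-TD t slope-α slope-β λ {i} {j} i≢j →
      let Δ = Linear.det t {suc (suc d)} slope-α slope-β i j in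
      e ℤ.* f Δ , subst (λ z → + t ∣ᶻ z ℤ.- 1ℤ)
        (trans (cong (e ℤ.*_) (sym (cofactor i j i≢j))) (sym (ℤ.*-assoc e (f Δ) Δ))) unit

  odd-HasTD : ∀ h → HasTD (suc (2 ℕ.* h))
  odd-HasTD h = slopes-TD (suc (2 ℕ.* h)) 2 (+ 2) (+ suc h) f (divides 1ℤ unit) (toWitness {a? = all? λ i → all? λ j → ¬? (i ≟ᶠ j) →-dec (_ ℤ.≟ _)} tt)
    where
    f : ℤ → ℤ
    f (+ 1) = + 2
    f (+ 2) = + 1
    f -[1+ 0 ] = -[1+ 1 ]
    f -[1+ 1 ] = -[1+ 0 ]
    f _ = 0ℤ
    unit : + suc h ℤ.* + 2 ℤ.- 1ℤ ≡ 1ℤ ℤ.* + suc (2 ℕ.* h)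
    unit = begin
      + suc h ℤ.* + 2 ℤ.- 1ℤ       ≡⟨ cong (λ z → z ℤ.* + 2 ℤ.- 1ℤ) (ℤ.pos-+ 1 h) ⟩
      (1ℤ ℤ.+ + h) ℤ.* + 2 ℤ.- 1ℤ  ≡⟨ solve 1 (λ h → (con 1ℤ :+ h) :* con (+ 2) :- con 1ℤ := con 1ℤ :* (con 1ℤ :+ con (+ 2) :* h)) refl (+ h) ⟩
      1ℤ ℤ.* (1ℤ ℤ.+ + 2 ℤ.* + h)  ≡⟨ cong (λ z → 1ℤ ℤ.* (1ℤ ℤ.+ z)) (ℤ.pos-* 2 h) ⟨
      1ℤ ℤ.* + suc (2 ℕ.* h)       ∎
      where open ≡-Reasoning

  -- Slopes 0 to 3 differ by at most 3, and 6 is the least common multiple of 1, 2, 3. Wilson's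
  -- construction needs this fifth group in order to truncate it.
  TD-5 : ∀ t .{{_ : NonZero t}} (e : ℤ) → + t ∣ᶻ e ℤ.* + 6 ℤ.- 1ℤ → TD 5 (Fin t)
  TD-5 t e unit = slopes-TD t 3 (+ 6) e f unit (toWitness {a? = all? λ i → all? λ j → ¬? (i ≟ᶠ j) →-dec (_ ℤ.≟ _)} tt)
    where
    f : ℤ → ℤ
    f (+ 1) = + 6
    f (+ 2) = + 3
    f (+ 3) = + 2
    f -[1+ 0 ] = -[1+ 5 ]
    f -[1+ 1 ] = -[1+ 2 ]
    f -[1+ 2 ] = -[1+ 1 ]
    f _ = 0ℤ

  TD-5-6a+1 : ∀ a → TD 5 (Fin (suc (6 ℕ.* a)))
  TD-5-6a+1 a = TD-5 (suc (6 ℕ.* a)) (ℤ.- + a) (divides (ℤ.- 1ℤ) (begin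
      (ℤ.- + a) ℤ.* + 6 ℤ.- 1ℤ          ≡⟨ solve 1 (λ a → (:- a) :* con (+ 6) :- con 1ℤ := (:- con 1ℤ) :* (con 1ℤ :+ con (+ 6) :* a)) refl (+ a) ⟩
      (ℤ.- 1ℤ) ℤ.* (1ℤ ℤ.+ + 6 ℤ.* + a) ≡⟨ cong (λ z → (ℤ.- 1ℤ) ℤ.* (1ℤ ℤ.+ z)) (ℤ.pos-* 6 a) ⟨
      (ℤ.- 1ℤ) ℤ.* + suc (6 ℕ.* a)      ∎))
    where open ≡-Reasoning

  TD-5-6a+5 : ∀ a → TD 5 (Fin (5 ℕ.+ 6 ℕ.* a))
  TD-5-6a+5 a = TD-5 (5 ℕ.+ 6 ℕ.* a) (1ℤ ℤ.+ + a) (divides 1ℤ (begin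
      (1ℤ ℤ.+ + a) ℤ.* + 6 ℤ.- 1ℤ     ≡⟨ solve 1 (λ a → (con 1ℤ :+ a) :* con (+ 6) :- con 1ℤ := con 1ℤ :* (con (+ 5) :+ con (+ 6) :* a)) refl (+ a) ⟩
      1ℤ ℤ.* (+ 5 ℤ.+ + 6 ℤ.* + a)    ≡⟨ cong (λ z → 1ℤ ℤ.* (+ 5 ℤ.+ z)) (ℤ.pos-* 6 a) ⟨
      1ℤ ℤ.* + (5 ℕ.+ 6 ℕ.* a)        ∎))
    where open ≡-Reasoning

  4-HasTD : HasTD 4
  4-HasTD = fill-HasTD ITD-3-1 (odd-HasTD 0)

  -- Weight 3 works because designs exist of both orders 3 and 3 + 1, the latter with a point as
  -- hole; the hole of size u is filled last.
  wilson-HasTD : ∀ u r → TD 5 (Fin (u ℕ.+ r)) → HasTD u → HasTD ((u ℕ.+ r) ℕ.* 3 ℕ.+ u)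
  wilson-HasTD u r D E = transport-TD (↔-sym ((*↔× ⊎-↔ ↔-id (Fin u)) ↔-∘ +↔⊎))
    (fill-hole (Wilson.wilson-ITD +↔⊎ D (odd-HasTD 1) ITD-3-1) E)

open WilsonConstruction

-- Orthogonal Latin squares of every order other than 2 and 6

module OrthogonalLatinSquares where
  open import Data.Nat using (_+_; _*_; _∸_; _≤?_; _≟_)
  open import Data.Nat.DivMod using (_/_; _%_; m≡m%n+[m/n]*n; m%n<n; /-monoˡ-≤)
  open import Relation.Nullary.Decidable using (from-yes)

  parity : ∀ n → (∃ λ h → n ≡ 2 * h) ⊎ (∃ λ h → n ≡ suc (2 * h))
  parity zero = inj₁ (0 , refl)
  parity (suc n) with parity n
  ... | inj₁ (h , n≡2h) = inj₂ (h , cong suc n≡2h)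
  ... | inj₂ (h , n≡1+2h) = inj₁ (suc h , trans (cong suc n≡1+2h) (sym (ℕ.*-suc 2 h)))

  -- With t = 6a + 1 and u = 2h + 1 the order 3t + u is 2(9a + 2 + h); the bounds on v say 0 ≤ h ≤
  -- 3a, that is u ≤ t. An odd u always has its own design.
  wilson-1 : ∀ a v → 9 * a + 2 ≤ v → v ≤ 12 * a + 2 → HasTD (2 * v)
  wilson-1 a v lo hi with ℕ.m≤n⇒∃[o]m+o≡n lo | ℕ.m≤n⇒∃[o]m+o≡n hi
  ... | h , refl | g , v+g≡ = cast-HasTD
      (trans (cong (λ t → t * 3 + suc (2 * h)) t≡) (lemma a h))
      (wilson-HasTD (suc (2 * h)) (2 * g) (subst (λ t → TD 5 (Fin t)) (sym t≡) (TD-5-6a+1 a)) (odd-HasTD h))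
    where
    h+g≡3a : h + g ≡ 3 * a
    h+g≡3a = ℕ.+-cancelˡ-≡ (9 * a + 2) _ _ (trans (sym (ℕ.+-assoc (9 * a + 2) h g)) (trans v+g≡ (solve-12 a)))
      where
      solve-12 : ∀ a → 12 * a + 2 ≡ 9 * a + 2 + 3 * a
      solve-12 = solve-∀
    t≡ : suc (2 * h) + 2 * g ≡ suc (6 * a)
    t≡ = cong suc (trans (sym (ℕ.*-distribˡ-+ 2 h g)) (trans (cong (2 *_) h+g≡3a) (sym (ℕ.*-assoc 2 3 a))))
    lemma : ∀ a h → suc (6 * a) * 3 + suc (2 * h) ≡ 2 * (9 * a + 2 + h)
    lemma = solve-∀

  -- The same with t = 6a + 5, where the order is 2(9a + 8 + h) and 0 ≤ h ≤ 3a + 2.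
  wilson-5 : ∀ a v → 9 * a + 8 ≤ v → v ≤ 12 * a + 10 → HasTD (2 * v)
  wilson-5 a v lo hi with ℕ.m≤n⇒∃[o]m+o≡n lo | ℕ.m≤n⇒∃[o]m+o≡n hi
  ... | h , refl | g , v+g≡ = cast-HasTD
      (trans (cong (λ t → t * 3 + suc (2 * h)) t≡) (lemma a h))
      (wilson-HasTD (suc (2 * h)) (2 * g) (subst (λ t → TD 5 (Fin t)) (sym t≡) (TD-5-6a+5 a)) (odd-HasTD h))
    where
    h+g≡3a+2 : h + g ≡ 3 * a + 2
    h+g≡3a+2 = ℕ.+-cancelˡ-≡ (9 * a + 8) _ _ (trans (sym (ℕ.+-assoc (9 * a + 8) h g)) (trans v+g≡ (solve-12 a)))
      where
      solve-12 : ∀ a → 12 * a + 10 ≡ 9 * a + 8 + (3 * a + 2)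
      solve-12 = solve-∀
    t≡ : suc (2 * h) + 2 * g ≡ 5 + 6 * a
    t≡ = cong suc (trans (sym (ℕ.*-distribˡ-+ 2 h g)) (trans (cong (2 *_) h+g≡3a+2) (double a)))
      where
      double : ∀ a → 2 * (3 * a + 2) ≡ 4 + 6 * a
      double = solve-∀
    lemma : ∀ a h → (5 + 6 * a) * 3 + suc (2 * h) ≡ 2 * (9 * a + 8 + h)
    lemma = solve-∀

  -- The intervals from 9a + 2 to 12a + 2 leave no gap once 3a ≥ 8, so from a = 3 and v = 29 on; a
  -- is the quotient of v - 2 by 9, and the remainder is at most 8.
  large-even-HasTD : ∀ v → 29 ≤ v → HasTD (2 * v)
  large-even-HasTD v 29≤v = wilson-1 a v lo hi
    where
    a = (v ∸ 2) / 9
    v≡ : v ≡ (v ∸ 2) % 9 + a * 9 + 2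
    v≡ = trans (sym (ℕ.m∸n+n≡m (ℕ.≤-trans (from-yes (2 ≤? 29)) 29≤v))) (cong (_+ 2) (m≡m%n+[m/n]*n (v ∸ 2) 9))
    lo : 9 * a + 2 ≤ v
    lo = subst (9 * a + 2 ≤_) (sym v≡) (ℕ.+-monoˡ-≤ 2 (subst (_≤ (v ∸ 2) % 9 + a * 9) (ℕ.*-comm a 9) (ℕ.m≤n+m (a * 9) _)))
    3≤a : 3 ≤ a
    3≤a = /-monoˡ-≤ 9 (ℕ.∸-monoˡ-≤ 2 29≤v)
    hi : v ≤ 12 * a + 2
    hi = subst (_≤ 12 * a + 2) (sym v≡) (ℕ.+-monoˡ-≤ 2 (ℕ.≤-trans
      (ℕ.+-monoˡ-≤ (a * 9) (ℕ.≤-trans (ℕ.≤-pred (m%n<n (v ∸ 2) 9)) (ℕ.≤-trans (from-yes (8 ≤? 9)) (ℕ.*-monoʳ-≤ 3 3≤a))))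
      (ℕ.≤-reflexive (lemma a))))
      where
      lemma : ∀ a → 3 * a + a * 9 ≡ 12 * a
      lemma = solve-∀

  8-HasTD : HasTD 8
  8-HasTD = fill-HasTD ITD-7-1 (odd-HasTD 0)

  10-HasTD : HasTD 10
  10-HasTD = fill-HasTD ITD-7-3 (odd-HasTD 1)

  -- The ranges 8-10, 11-14, 17-22, 20-26 and 26-34 of Wilson's construction reach the uniform bound
  -- 29. Tables give the orders 4, 8, 10, 14, and products give 12 = 4 · 3, 30 = 10 · 3 and 32 = 8 ·
  -- 4.
  even-HasTD : ∀ v → 1 ≤ v → v ≢ 1 → v ≢ 3 → HasTD (2 * v)
  even-HasTD 1 _ v≢1 _ = contradiction refl v≢1
  even-HasTD 2 _ _ _ = 4-HasTD
  even-HasTD 3 _ _ v≢3 = contradiction refl v≢3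
  even-HasTD 4 _ _ _ = 8-HasTD
  even-HasTD 5 _ _ _ = 10-HasTD
  even-HasTD 6 _ _ _ = product-HasTD 4-HasTD (odd-HasTD 1)
  even-HasTD 7 _ _ _ = fill-HasTD ITD-11-3 (odd-HasTD 1)
  even-HasTD v@(suc (suc (suc (suc (suc (suc (suc (suc _)))))))) _ _ _
    with v ≤? 10 | v ≤? 14 | v ≟ 15 | v ≟ 16 | v ≤? 22 | v ≤? 26 | v ≤? 28
  ... | yes v≤ | _ | _ | _ | _ | _ | _ = wilson-5 0 v (ℕ.m≤m+n 8 _) v≤
  ... | no v≰ | yes v≤ | _ | _ | _ | _ | _ = wilson-1 1 v (ℕ.≰⇒> v≰) v≤
  ... | _ | _ | yes refl | _ | _ | _ | _ = product-HasTD 10-HasTD (odd-HasTD 1)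
  ... | _ | _ | _ | yes refl | _ | _ | _ = product-HasTD 8-HasTD 4-HasTD
  ... | _ | no v≰ | no v≢15 | no v≢16 | yes v≤ | _ | _ =
    wilson-5 1 v (ℕ.≤∧≢⇒< (ℕ.≤∧≢⇒< (ℕ.≰⇒> v≰) (v≢15 ∘ sym)) (v≢16 ∘ sym)) v≤
  ... | _ | _ | _ | _ | no v≰ | yes v≤ | _ = wilson-1 2 v (ℕ.≤-trans (from-yes (20 ≤? 23)) (ℕ.≰⇒> v≰)) v≤
  ... | _ | _ | _ | _ | _ | no v≰ | yes v≤ =
    wilson-5 2 v (ℕ.≤-trans (from-yes (26 ≤? 27)) (ℕ.≰⇒> v≰)) (ℕ.≤-trans v≤ (from-yes (28 ≤? 34)))
  ... | _ | _ | _ | _ | _ | _ | no v≰ = large-even-HasTD v (ℕ.≰⇒> v≰)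

  -- The theorem of Bose, Shrikhande and Parker.
  four-group-TD : ∀ w → 1 ≤ w → w ≢ 2 → w ≢ 6 → HasTD w
  four-group-TD w 1≤w w≢2 w≢6 with parity w
  ... | inj₁ (zero , refl) = contradiction 1≤w λ ()
  ... | inj₁ (v@(suc _) , refl) = even-HasTD v (s≤s z≤n) (w≢2 ∘ cong (2 *_)) (w≢6 ∘ cong (2 *_))
  ... | inj₂ (h , refl) = odd-HasTD h

open OrthogonalLatinSquares

-- Distributing s and r over the w blocks

module BalancedBlocks where
  open import Data.Fin.Properties using (+↔⊎)
  open import Data.Nat using (_+_; _*_; _∸_; _≤?_; _≟_)
  open import Data.Sum.Properties using (swap-↔)
  open import Relation.Nullary.Decidable using (from-yes)

  ×-distrib-⊎ : ∀ {A B C : Set} → ((A ⊎ B) × C) ↔ ((A × C) ⊎ (B × C))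
  ×-distrib-⊎ = mk↔ₛ′
    (λ { (inj₁ a , c) → inj₁ (a , c) ; (inj₂ b , c) → inj₂ (b , c) })
    (λ { (inj₁ (a , c)) → inj₁ a , c ; (inj₂ (b , c)) → inj₂ b , c })
    (λ { (inj₁ _) → refl ; (inj₂ _) → refl })
    (λ { (inj₁ _ , _) → refl ; (inj₂ _ , _) → refl })

  ⊎-interchange : ∀ {A B C D : Set} → ((A ⊎ B) ⊎ (C ⊎ D)) ↔ ((A ⊎ C) ⊎ (B ⊎ D))
  ⊎-interchange = mk↔ₛ′ f f inv inv
    where
    f : ∀ {A B C D : Set} → (A ⊎ B) ⊎ (C ⊎ D) → (A ⊎ C) ⊎ (B ⊎ D)
    f (inj₁ (inj₁ a)) = inj₁ (inj₁ a)
    f (inj₁ (inj₂ b)) = inj₂ (inj₁ b)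
    f (inj₂ (inj₁ c)) = inj₁ (inj₂ c)
    f (inj₂ (inj₂ d)) = inj₂ (inj₂ d)
    inv : ∀ {A B C D : Set} (z : (A ⊎ B) ⊎ (C ⊎ D)) → f (f z) ≡ z
    inv (inj₁ (inj₁ _)) = refl
    inv (inj₁ (inj₂ _)) = refl
    inv (inj₂ (inj₁ _)) = refl
    inv (inj₂ (inj₂ _)) = refl

  private
    pred+2 : ∀ u → 3 ≤ u → (u ∸ 1) + 2 ≡ 1 + u
    pred+2 (suc u) _ = ℕ.+-comm u 2

    pred≢1 : ∀ u → 3 ≤ u → u ∸ 1 ≢ 1
    pred≢1 _ (s≤s (s≤s (s≤s _))) ()

    ∸2+3 : ∀ u → 5 ≤ u → (u ∸ 2) + 3 ≡ 1 + u
    ∸2+3 (suc (suc u)) _ = ℕ.+-comm u 3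
    ∸2+3 1 (s≤s ())

    ∸2+2 : ∀ u → 5 ≤ u → (u ∸ 2) + 2 ≡ u
    ∸2+2 (suc (suc u)) _ = ℕ.+-comm u 2
    ∸2+2 1 (s≤s ())

    3+∸3 : ∀ u → 5 ≤ u → 3 + (u ∸ 3) ≡ u
    3+∸3 _ (s≤s (s≤s (s≤s _))) = refl

    ∸2≢1 : ∀ u → 5 ≤ u → u ∸ 2 ≢ 1
    ∸2≢1 _ (s≤s (s≤s (s≤s (s≤s _)))) ()

    ∸3≢1 : ∀ u → 5 ≤ u → u ∸ 3 ≢ 1
    ∸3≢1 _ (s≤s (s≤s (s≤s (s≤s (s≤s _))))) ()

  module Schedules {u} (𝔾 : FiniteAbelianGroup u) where
    open FiniteAbelianGroup 𝔾 using (G; 0#; sum; sum-cong-≗; +-assoc; +-identityˡ) renaming (_+_ to _⊕_)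

    -- For every w ∈ W, u group elements with sum zero; altogether those indexed by S satisfy P
    -- and those indexed by R satisfy Q.
    record Schedule (P Q : G → Set) (W S R : Set) : Set where
      field
        rows : (W × Fin u) ↔ (S ⊎ R)
        shift : S ⊎ R → G
        left-ok : ∀ s → P (shift (inj₁ s))
        right-ok : ∀ r → Q (shift (inj₂ r))
        balanced : ∀ w → sum (λ k → shift (to rows (w , k))) ≡ 0#
    open Schedule

    transport-Schedule : ∀ {P Q W S R W′ S′ R′} → W′ ↔ W → S ↔ S′ → R ↔ R′ → Schedule P Q W S R → Schedule P Q W′ S′ R′
    transport-Schedule {S = S} {R} {S′ = S′} {R′} w s r 𝒮 = record
      { rows = (s ⊎-↔ r) ↔-∘ (rows 𝒮 ↔-∘ (w ×-↔ ↔-id _))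
      ; shift = shift 𝒮 ∘ from (s ⊎-↔ r)
      ; left-ok = λ i → left-ok 𝒮 (from s i)
      ; right-ok = λ i → right-ok 𝒮 (from r i)
      ; balanced = λ f → trans
          (sum-cong-≗ (λ k → cong (shift 𝒮) (strictlyInverseʳ (s ⊎-↔ r) (to (rows 𝒮) (to w f , k)))))
          (balanced 𝒮 (to w f)) }

    swap-Schedule : ∀ {P Q W S R} → Schedule P Q W S R → Schedule Q P W R S
    swap-Schedule 𝒮 = record
      { rows = swap-↔ ↔-∘ rows 𝒮
      ; shift = shift 𝒮 ∘ swap
      ; left-ok = right-ok 𝒮
      ; right-ok = left-ok 𝒮
      ; balanced = λ w → trans (sum-cong-≗ (λ k → cong (shift 𝒮) (strictlyInverseʳ swap-↔ (to (rows 𝒮) (w , k))))) (balanced 𝒮 w) }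

    append-Schedule : ∀ {P Q W S R W′ S′ R′} → Schedule P Q W S R → Schedule P Q W′ S′ R′ → Schedule P Q (W ⊎ W′) (S ⊎ S′) (R ⊎ R′)
    append-Schedule {P} {Q} {W} {S} {R} {W′} {S′} {R′} 𝒮 𝒯 = record
      { rows = ⊎-interchange ↔-∘ ((rows 𝒮 ⊎-↔ rows 𝒯) ↔-∘ ×-distrib-⊎)
      ; shift = sh
      ; left-ok = λ { (inj₁ s) → left-ok 𝒮 s ; (inj₂ s) → left-ok 𝒯 s }
      ; right-ok = λ { (inj₁ r) → right-ok 𝒮 r ; (inj₂ r) → right-ok 𝒯 r }
      ; balanced = λ
          { (inj₁ w) → trans (sum-cong-≗ (λ k → sh-𝒮 (to (rows 𝒮) (w , k)))) (balanced 𝒮 w)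
          ; (inj₂ w) → trans (sum-cong-≗ (λ k → sh-𝒯 (to (rows 𝒯) (w , k)))) (balanced 𝒯 w) } }
      where
      sh : (S ⊎ S′) ⊎ (R ⊎ R′) → G
      sh = [ [ shift 𝒮 ∘ inj₁ , shift 𝒯 ∘ inj₁ ] , [ shift 𝒮 ∘ inj₂ , shift 𝒯 ∘ inj₂ ] ]
      sh-𝒮 : ∀ x → sh (to ⊎-interchange (inj₁ x)) ≡ shift 𝒮 x
      sh-𝒮 (inj₁ _) = refl
      sh-𝒮 (inj₂ _) = refl
      sh-𝒯 : ∀ x → sh (to ⊎-interchange (inj₂ x)) ≡ shift 𝒯 x
      sh-𝒯 (inj₁ _) = refl
      sh-𝒯 (inj₂ _) = refl

    ZeroSum : (G → Set) → ℕ → Set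
    ZeroSum P s = Σ (Fin s → G) λ a → (∀ i → P (a i)) × sum a ≡ 0#

    sum-splitAt : ∀ s {r} (a : Fin s → G) (b : Fin r → G) → sum ([ a , b ]′ ∘ splitAt s {r}) ≡ sum a ⊕ sum b
    sum-splitAt zero a b = sym (+-identityˡ _)
    sum-splitAt (suc s) {r} a b = trans
        (cong (a zero ⊕_) (trans (sum-cong-≗ (λ k → map₁-suc (splitAt s k))) (sum-splitAt s (a ∘ suc) b)))
        (sym (+-assoc _ _ _))
      where
      map₁-suc : ∀ z → [ a , b ]′ (map₁ suc z) ≡ [ a ∘ suc , b ]′ z
      map₁-suc (inj₁ _) = refl
      map₁-suc (inj₂ _) = refl

    Sch : (P Q : G → Set) → ℕ → ℕ → ℕ → Set
    Sch P Q w s r = Schedule P Q (Fin w) (Fin s) (Fin r)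

    block : ∀ {P Q s r} → s + r ≡ u → ZeroSum P s → ZeroSum Q r → Sch P Q 1 s r
    block {s = s} refl (a , a-ok , Σa) (b , b-ok , Σb) = record
      { rows = +↔⊎ ↔-∘ mk↔ₛ′ proj₂ (zero ,_) (λ _ → refl) (λ { (zero , _) → refl })
      ; shift = [ a , b ]′
      ; left-ok = a-ok
      ; right-ok = b-ok
      ; balanced = λ _ → trans (sum-splitAt s a b) (trans (cong₂ _⊕_ Σa Σb) (+-identityˡ 0#)) }

    -- When both sides want the same order, one zero-sum family is cut anywhere; its halves need not
    -- have zero sum, so a half may be a singleton.
    mixed-block : ∀ {P s r} → s + r ≡ u → ZeroSum P u → Sch P P 1 s r
    mixed-block {s = s} {r} refl (a , a-ok , Σa) = record
      { rows = +↔⊎ ↔-∘ mk↔ₛ′ proj₂ (zero ,_) (λ _ → refl) (λ { (zero , _) → refl })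
      ; shift = a ∘ from (+↔⊎ {s} {r})
      ; left-ok = λ i → a-ok _
      ; right-ok = λ i → a-ok _
      ; balanced = λ _ → trans (sum-cong-≗ (λ k → cong a (strictlyInverseʳ (+↔⊎ {s} {r}) k))) Σa }

    append : ∀ {P Q w s r w′ s′ r′} → Sch P Q w s r → Sch P Q w′ s′ r′ → Sch P Q (w + w′) (s + s′) (r + r′)
    append 𝒮 𝒯 = transport-Schedule +↔⊎ (↔-sym +↔⊎) (↔-sym +↔⊎) (append-Schedule 𝒮 𝒯)

    cast-Sch : ∀ {P Q w s r s′ r′} → s ≡ s′ → r ≡ r′ → Sch P Q w s r → Sch P Q w s′ r′
    cast-Sch refl refl 𝒮 = 𝒮

    module _ {P Q : G → Set} where

      private
        peel : ∀ {w s r s₀ r₀} → s₀ ≤ s → r₀ ≤ r → Sch P Q 1 s₀ r₀ → Sch P Q w (s ∸ s₀) (r ∸ r₀) → Sch P Q (suc w) s r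
        peel s₀≤s r₀≤r 𝒮 𝒯 = cast-Sch (ℕ.m+[n∸m]≡n s₀≤s) (ℕ.m+[n∸m]≡n r₀≤r) (append 𝒮 𝒯)

        rest-total : ∀ {w s r s₀ r₀} → s₀ ≤ s → r₀ ≤ r → s₀ + r₀ ≡ u → s + r ≡ u + w → (s ∸ s₀) + (r ∸ r₀) ≡ w
        rest-total {w} {s} {r} {s₀} {r₀} s₀≤s r₀≤r refl s+r≡ = ℕ.+-cancelˡ-≡ (s₀ + r₀) _ _ (begin
            s₀ + r₀ + ((s ∸ s₀) + (r ∸ r₀)) ≡⟨ interchange s₀ r₀ _ _ ⟩
            (s₀ + (s ∸ s₀)) + (r₀ + (r ∸ r₀)) ≡⟨ cong₂ _+_ (ℕ.m+[n∸m]≡n s₀≤s) (ℕ.m+[n∸m]≡n r₀≤r) ⟩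
            s + r ≡⟨ s+r≡ ⟩
            s₀ + r₀ + w ∎)
          where
          open ≡-Reasoning
          interchange : ∀ a b c d → a + b + (c + d) ≡ (a + c) + (b + d)
          interchange = solve-∀

      -- Greedy: full left blocks as long as possible, then one block with what is left of s, then
      -- right blocks.
      split-any : (∀ {s r} → s + r ≡ u → Sch P Q 1 s r) → ∀ w {s r} → s + r ≡ suc w * u → Sch P Q (suc w) s r
      split-any blk zero s+r≡ = blk (trans s+r≡ (ℕ.*-identityˡ u))
      split-any blk (suc w) {s} {r} s+r≡ with u ≤? s
      ... | yes u≤s = peel u≤s z≤n (blk (ℕ.+-identityʳ u)) (split-any blk w (rest-total u≤s z≤n (ℕ.+-identityʳ u) s+r≡))
      ... | no u≰s = peel ℕ.≤-refl u∸s≤r (blk s+[u∸s]≡u) (split-any blk w (rest-total ℕ.≤-refl u∸s≤r s+[u∸s]≡u s+r≡))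
        where
        s≤u : s ≤ u
        s≤u = ℕ.<⇒≤ (ℕ.≰⇒> u≰s)
        s+[u∸s]≡u : s + (u ∸ s) ≡ u
        s+[u∸s]≡u = ℕ.m+[n∸m]≡n s≤u
        u∸s≤r : u ∸ s ≤ r
        u∸s≤r = ℕ.m≤n+o⇒m∸n≤o u s (subst (u ≤_) (sym s+r≡) (ℕ.m≤m+n u _))

      split-left : 3 ≤ u → (∀ {s r} → s + r ≡ u → s ≢ 1 → Sch P Q 1 s r) →
        ∀ w {s r} → s + r ≡ suc w * u → s ≢ 1 → Sch P Q (suc w) s r
      split-left 3≤u blk zero s+r≡ s≢1 = blk (trans s+r≡ (ℕ.*-identityˡ u)) s≢1
      split-left 3≤u blk (suc w) {s} {r} s+r≡ s≢1 with u ≤? s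
      ... | no u≰s = peel ℕ.≤-refl u∸s≤r (blk s+[u∸s]≡u s≢1)
              (split-left 3≤u blk w (rest-total ℕ.≤-refl u∸s≤r s+[u∸s]≡u s+r≡) (λ s∸s≡1 → ℕ.0≢1+n (trans (sym (ℕ.n∸n≡0 s)) s∸s≡1)))
        where
        s≤u : s ≤ u
        s≤u = ℕ.<⇒≤ (ℕ.≰⇒> u≰s)
        s+[u∸s]≡u : s + (u ∸ s) ≡ u
        s+[u∸s]≡u = ℕ.m+[n∸m]≡n s≤u
        u∸s≤r : u ∸ s ≤ r
        u∸s≤r = ℕ.m≤n+o⇒m∸n≤o u s (subst (u ≤_) (sym s+r≡) (ℕ.m≤m+n u _))
      ... | yes u≤s with s ∸ u ≟ 1
      ...   | no s∸u≢1 = peel u≤s z≤n (blk (ℕ.+-identityʳ u) (λ { refl → contradiction 3≤u λ { (s≤s ()) } }))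
                (split-left 3≤u blk w (rest-total u≤s z≤n (ℕ.+-identityʳ u) s+r≡) s∸u≢1)
      -- A full block would strand one left element. It takes u - 1 instead, so 2 are left over; its
      -- remaining place goes to a single right element, which `blk` permits.
      ...   | yes s∸u≡1 = cast-Sch (trans (pred+2 u 3≤u) (sym s≡1+u)) (ℕ.m+[n∸m]≡n 1≤r)
                (append (blk (ℕ.m∸n+n≡m 1≤u) (pred≢1 u 3≤u)) (split-left 3≤u blk w rest λ ()))
        where
        1≤u : 1 ≤ u
        1≤u = ℕ.≤-trans (s≤s z≤n) 3≤u
        s≡1+u : s ≡ 1 + u
        s≡1+u = trans (sym (ℕ.m∸n+n≡m u≤s)) (cong (_+ u) s∸u≡1)
        1+r≡ : 1 + r ≡ suc w * u
        1+r≡ = ℕ.+-cancelˡ-≡ u _ _ (trans (ℕ.+-suc u r) (trans (cong (_+ r) (sym s≡1+u)) s+r≡))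
        1≤r : 1 ≤ r
        1≤r = ℕ.≤-pred (ℕ.≤-trans (ℕ.≤-trans (from-yes (2 ≤? 3)) 3≤u) (subst (u ≤_) (sym 1+r≡) (ℕ.m≤m+n u _)))
        rest : 2 + (r ∸ 1) ≡ suc w * u
        rest = trans (cong suc (ℕ.m+[n∸m]≡n 1≤r)) 1+r≡

      private
        -- For the totals u + 1 and u - 1 the split is u + 1 = (u - 2) + 3 and u - 1 = 2 + (u - 3).
        -- The bound u ≥ 5 keeps u - 3 away from 1.
        two-blocks : 5 ≤ u → (∀ {s r} → s + r ≡ u → s ≢ 1 → r ≢ 1 → Sch P Q 1 s r) →
          ∀ {r} → 1 + r ≡ u → Sch P Q 2 (1 + u) r
        two-blocks 5≤u blk 1+r≡u = cast-Sch (∸2+3 u 5≤u) (ℕ.suc-injective (trans (3+∸3 u 5≤u) (sym 1+r≡u)))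
          (append (blk (∸2+2 u 5≤u) (∸2≢1 u 5≤u) (λ ())) (blk (3+∸3 u 5≤u) (λ ()) (∸3≢1 u 5≤u)))

        two-blocks′ : 5 ≤ u → (∀ {s r} → s + r ≡ u → s ≢ 1 → r ≢ 1 → Sch P Q 1 s r) →
          ∀ {s} → 1 + s ≡ u → Sch P Q 2 s (1 + u)
        two-blocks′ 5≤u blk 1+s≡u = cast-Sch (ℕ.suc-injective (trans (3+∸3 u 5≤u) (sym 1+s≡u))) (∸2+3 u 5≤u)
          (append (blk (trans (ℕ.+-comm 2 _) (∸2+2 u 5≤u)) (λ ()) (∸2≢1 u 5≤u))
                  (blk (trans (ℕ.+-comm _ 3) (3+∸3 u 5≤u)) (∸3≢1 u 5≤u) (λ ())))

        exactly-two : ∀ w s r → 5 ≤ u → s ≡ 1 + u → r < u → s + r ≡ suc (suc w) * u → w ≡ 0 × 1 + r ≡ u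
        exactly-two w s r 5≤u refl r<u s+r≡ = w≡0 w 1+r≡ , ℕ.≤-antisym r<u (subst (u ≤_) (sym 1+r≡) (ℕ.m≤m+n u _))
          where
          1+r≡ : 1 + r ≡ suc w * u
          1+r≡ = ℕ.+-cancelˡ-≡ u _ _ (trans (ℕ.+-suc u r) s+r≡)
          w≡0 : ∀ w → 1 + r ≡ suc w * u → w ≡ 0
          w≡0 zero _ = refl
          w≡0 (suc w) eq = contradiction (ℕ.≤-trans (ℕ.+-monoʳ-≤ u (ℕ.≤-trans (ℕ.≤-trans (from-yes (1 ≤? 5)) 5≤u) (ℕ.m≤m+n u (w * u))))
            (subst (_≤ u) eq r<u)) (ℕ.m+1+n≰m u)

      -- A full block of either side is removed unless this strands one element there. If neither
      -- side permits it, one total is u + 1 and the other is below u, which forces two blocks with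
      -- totals u + 1 and u - 1.
      split-both : 5 ≤ u → (∀ {s r} → s + r ≡ u → s ≢ 1 → r ≢ 1 → Sch P Q 1 s r) →
        ∀ w {s r} → s + r ≡ suc w * u → s ≢ 1 → r ≢ 1 → Sch P Q (suc w) s r
      split-both 5≤u blk zero s+r≡ s≢1 r≢1 = blk (trans s+r≡ (ℕ.*-identityˡ u)) s≢1 r≢1
      split-both 5≤u blk (suc w) {s} {r} s+r≡ s≢1 r≢1 = go (u ≤? s) (s ∸ u ≟ 1) (u ≤? r) (r ∸ u ≟ 1)
        where
        u≢1 : u ≢ 1
        u≢1 refl = contradiction 5≤u λ { (s≤s ()) }
        go : Dec (u ≤ s) → Dec (s ∸ u ≡ 1) → Dec (u ≤ r) → Dec (r ∸ u ≡ 1) → Sch P Q (suc (suc w)) s r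
        go (yes u≤s) (no s∸u≢1) _ _ = peel u≤s z≤n (blk (ℕ.+-identityʳ u) u≢1 (λ ()))
          (split-both 5≤u blk w (rest-total u≤s z≤n (ℕ.+-identityʳ u) s+r≡) s∸u≢1 r≢1)
        go _ _ (yes u≤r) (no r∸u≢1) = peel z≤n u≤r (blk refl (λ ()) u≢1)
          (split-both 5≤u blk w (rest-total z≤n u≤r refl s+r≡) s≢1 r∸u≢1)
        go (yes u≤s) (yes s∸u≡1) (no u≰r) _
          with trans (sym (ℕ.m∸n+n≡m u≤s)) (cong (_+ u) s∸u≡1)
        ... | s≡1+u with exactly-two w s r 5≤u s≡1+u (ℕ.≰⇒> u≰r) s+r≡
        ...   | refl , 1+r≡u = cast-Sch (sym s≡1+u) refl (two-blocks 5≤u blk 1+r≡u)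
        go (no u≰s) _ (yes u≤r) (yes r∸u≡1)
          with trans (sym (ℕ.m∸n+n≡m u≤r)) (cong (_+ u) r∸u≡1)
        ... | r≡1+u with exactly-two w r s 5≤u r≡1+u (ℕ.≰⇒> u≰s) (trans (ℕ.+-comm r s) s+r≡)
        ...   | refl , 1+s≡u = cast-Sch refl (sym r≡1+u) (two-blocks′ 5≤u blk 1+s≡u)
        go (no u≰s) _ (no u≰r) _ = contradiction
          (subst (_< u + u) s+r≡ (ℕ.+-mono-< (ℕ.≰⇒> u≰s) (ℕ.≰⇒> u≰r)))
          (ℕ.≤⇒≯ (ℕ.+-monoʳ-≤ u (ℕ.m≤m+n u (w * u))))
        -- Both totals equal to u + 1 would make 2 a multiple of u.
        go (yes u≤s) (yes s∸u≡1) (yes u≤r) (yes r∸u≡1) = contradiction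
          (ℕ.+-cancelˡ-≡ (u + u) _ _ (trans (trans (sum-lemma u) (cong₂ _+_ (sym s≡1+u) (sym r≡1+u))) (trans s+r≡ (sym (ℕ.+-assoc u u (w * u))))))
          (not-two w)
          where
          s≡1+u : s ≡ 1 + u
          s≡1+u = trans (sym (ℕ.m∸n+n≡m u≤s)) (cong (_+ u) s∸u≡1)
          r≡1+u : r ≡ 1 + u
          r≡1+u = trans (sym (ℕ.m∸n+n≡m u≤r)) (cong (_+ u) r∸u≡1)
          sum-lemma : ∀ u → u + u + 2 ≡ (1 + u) + (1 + u)
          sum-lemma = solve-∀
          not-two : ∀ w → 2 ≢ w * u
          not-two zero ()
          not-two (suc w) eq = contradiction (ℕ.≤-trans 5≤u (subst (u ≤_) (sym eq) (ℕ.m≤m+n u (w * u)))) λ { (s≤s (s≤s ())) }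

open BalancedBlocks

-- Element orders and zero-sum families

module ElementOrders where
  open import Defs using (Odd)
  import Algebra.Properties.Monoid.Mult as Multiples
  open import Data.Fin.Properties using (*↔×)
  open import Data.Integer as ℤ using (ℤ; +_; 0ℤ; 1ℤ)
  open import Data.Integer.Divisibility.Signed using (divides; ∣⇒∣ᵤ; ∣m∣n⇒∣m-n; ∣m⇒∣-m; ∣n⇒∣m*n; *-cancelʳ-∣) renaming (_∣_ to _∣ᶻ_)
  import Data.Integer.Properties as ℤ
  open import Data.Integer.Solver using (module +-*-Solver)
  open import Data.Nat.Divisibility as ℕ using (_∣_)
  import Data.Nat.Tactic.RingSolver as ℕ-Solver

  open +-*-Solver using (solve; _:+_; _:*_; :-_; _:-_; _:=_; con)

  IsOdd : ℕ → Set
  IsOdd n = ∃ λ h → n ≡ suc (2 ℕ.* h)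

  odd⇒IsOdd : ∀ {n} → Odd n → IsOdd n
  odd⇒IsOdd {n} odd with parity n
  ... | inj₁ (h , refl) = contradiction (ℕ.m∣m*n h) odd
  ... | inj₂ isOdd = isOdd

  *-IsOdd : ∀ {m n} → IsOdd m → IsOdd n → IsOdd (m ℕ.* n)
  *-IsOdd (a , refl) (b , refl) = a ℕ.+ b ℕ.+ 2 ℕ.* a ℕ.* b , lemma a b
    where
    lemma : ∀ a b → suc (2 ℕ.* a) ℕ.* suc (2 ℕ.* b) ≡ suc (2 ℕ.* (a ℕ.+ b ℕ.+ 2 ℕ.* a ℕ.* b))
    lemma = ℕ-Solver.solve-∀

  -- For m = 2h + 1, a = m a - h (2 a).
  odd-∣2* : ∀ {m} → IsOdd m → ∀ a → + m ∣ᶻ + 2 ℤ.* a → + m ∣ᶻ a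
  odd-∣2* {m} (h , refl) a m∣2a = subst (+ m ∣ᶻ_)
    (trans (cong (λ z → z ℤ.* a ℤ.- + h ℤ.* (+ 2 ℤ.* a)) (cong (λ z → 1ℤ ℤ.+ z) (ℤ.pos-* 2 h)))
      (solve 2 (λ h a → (con 1ℤ :+ con (+ 2) :* h) :* a :- h :* (con (+ 2) :* a) := a) refl (+ h) a))
    (∣m∣n⇒∣m-n (divides a (ℤ.*-comm (+ m) a)) (∣n⇒∣m*n (+ h) m∣2a))

  2∣∧odd∣⇒2*∣ : ∀ {ℓ} → IsOdd ℓ → ∀ {q} → 2 ∣ q → ℓ ∣ q → 2 ℕ.* ℓ ∣ q
  2∣∧odd∣⇒2*∣ {ℓ} (h , refl) {q} 2∣q (ℕ.divides k q≡kℓ) = subst (2 ℕ.* ℓ ∣_) (sym q≡kℓ)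
    (ℕ.*-monoˡ-∣ ℓ (ℕ.∣m+n∣m⇒∣n (subst (2 ∣_) (trans q≡kℓ (lemma k h)) 2∣q) (ℕ.m∣m*n (h ℕ.* k))))
    where
    lemma : ∀ k h → k ℕ.* suc (2 ℕ.* h) ≡ 2 ℕ.* (h ℕ.* k) ℕ.+ k
    lemma = ℕ-Solver.solve-∀

  module Orders {u} (𝔾 : FiniteAbelianGroup u) where
    open FiniteAbelianGroup 𝔾
    open Multiples monoid public using (×-homo-+) renaming (_×_ to _·_)
    open Schedules 𝔾 using (ZeroSum)
    open Exchange 𝔾 using (sum-bijection)

    HasOrder : ℕ → G → Set
    HasOrder ℓ g = ∀ q → (q · g ≡ 0# → ℓ ∣ q) × (ℓ ∣ q → q · g ≡ 0#)

    multiple-0# : ∀ q → q · 0# ≡ 0#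
    multiple-0# zero = refl
    multiple-0# (suc q) = trans (+-identityˡ _) (multiple-0# q)

    0#-order : HasOrder 1 0#
    0#-order q = (λ _ → ℕ.1∣ q) , λ _ → multiple-0# q

    involution-order : ∀ e → e ≢ 0# → e + e ≡ 0# → HasOrder 2 e
    involution-order e e≢0 e+e≡0 q = order⇒ q , λ { (ℕ.divides k refl) → order⇐ k }
      where
      order⇒ : ∀ q → q · e ≡ 0# → 2 ∣ q
      order⇒ zero _ = ℕ._∣0 2
      order⇒ (suc zero) eq = contradiction (trans (sym (+-identityʳ e)) eq) e≢0
      order⇒ (suc (suc q)) eq = ℕ.∣m∣n⇒∣m+n ℕ.∣-refl (order⇒ q (begin
        q · e           ≡⟨ +-identityˡ _ ⟨
        0# + q · e      ≡⟨ cong (_+ q · e) e+e≡0 ⟨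
        (e + e) + q · e ≡⟨ +-assoc e e _ ⟩
        e + (e + q · e) ≡⟨ eq ⟩
        0#              ∎))
        where open ≡-Reasoning
      order⇐ : ∀ k → (k ℕ.* 2) · e ≡ 0#
      order⇐ zero = refl
      order⇐ (suc k) = trans (sym (+-assoc e e _)) (trans (cong₂ _+_ e+e≡0 (order⇐ k)) (+-identityˡ 0#))

    -- A pair and a triple suffice: every s ≠ 1 is a sum of 2s with at most one 3.
    record ZeroSumPieces (P : G → Set) : Set where
      field
        pair : Fin 2 → G
        pair-ok : ∀ i → P (pair i)
        pair-sum : sum pair ≡ 0#
        triple : Fin 3 → G
        triple-ok : ∀ i → P (triple i)
        triple-sum : sum triple ≡ 0#

    zero-sum : ∀ {P} → ZeroSumPieces P → ∀ s → s ≢ 1 → ZeroSum P s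
    zero-sum pieces zero _ = (λ ()) , (λ ()) , refl
    zero-sum pieces 1 s≢1 = contradiction refl s≢1
    -- The triple must be used here, since removing a pair from 3 would leave 1.
    zero-sum pieces 3 _ = triple , triple-ok , triple-sum
      where open ZeroSumPieces pieces
    zero-sum {P} pieces (suc (suc s@zero)) _ = pair , pair-ok , pair-sum
      where open ZeroSumPieces pieces
    zero-sum {P} pieces (suc (suc s@(suc (suc _)))) _ with zero-sum pieces s (λ ())
    ... | a , a-ok , Σa = b , b-ok , (begin
        pair zero + (pair (suc zero) + sum a)   ≡⟨ cong (λ z → pair zero + (pair (suc zero) + z)) Σa ⟩
        pair zero + (pair (suc zero) + 0#)      ≡⟨ pair-sum ⟩
        0# ∎)
      where
      open ZeroSumPieces pieces
      open ≡-Reasoning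
      b : Fin (2 ℕ.+ s) → G
      b zero = pair zero
      b (suc zero) = pair (suc zero)
      b (suc (suc i)) = a i
      b-ok : ∀ i → P (b i)
      b-ok zero = pair-ok zero
      b-ok (suc zero) = pair-ok (suc zero)
      b-ok (suc (suc i)) = a-ok i

    zero-sum-0# : ∀ s → ZeroSum (HasOrder 1) s
    zero-sum-0# s = (λ _ → 0#) , (λ _ → 0#-order) , sum-0# s
      where
      sum-0# : ∀ s → sum {s} (λ _ → 0#) ≡ 0#
      sum-0# zero = refl
      sum-0# (suc s) = trans (+-identityˡ _) (sum-0# s)

    -- The sum of all elements is fixed by every automorphism.
    record FixedPointFreeAutomorphism : Set where
      field
        φ : G ↔ G
        φ-homo : ∀ x y → to φ (x + y) ≡ to φ x + to φ y
        φ-fixed : ∀ x → to φ x ≡ x → x ≡ 0#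

    total-sum≡0 : FixedPointFreeAutomorphism → sum (to enum) ≡ 0#
    total-sum≡0 A = φ-fixed _ (trans (φ-sum (to enum)) (sum-bijection (φ ↔-∘ enum)))
      where
      open FixedPointFreeAutomorphism A
      φ-0# : to φ 0# ≡ 0#
      φ-0# = +-cancelˡ (to φ 0#) _ _ (trans (sym (φ-homo 0# 0#)) (trans (cong (to φ) (+-identityˡ 0#)) (sym (+-identityʳ _))))
      φ-sum : ∀ {n} (f : Fin n → G) → to φ (sum f) ≡ sum (to φ ∘ f)
      φ-sum {zero} f = φ-0#
      φ-sum {suc n} f = trans (φ-homo _ _) (cong (λ z → to φ (f zero) + z) (φ-sum (f ∘ suc)))

  _×ᴳ_ : ∀ {u v} → FiniteAbelianGroup u → FiniteAbelianGroup v → FiniteAbelianGroup (u ℕ.* v)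
  𝔾 ×ᴳ ℍ = record
    { G = 𝔾.G × ℍ.G
    ; _+_ = λ (g , h) (g′ , h′) → g 𝔾.+ g′ , h ℍ.+ h′
    ; 0# = 𝔾.0# , ℍ.0#
    ; -_ = neg
    ; enum = (𝔾.enum ×-↔ ℍ.enum) ↔-∘ *↔×
    ; isAbelianGroup = record
      { isGroup = record
        { isMonoid = record
          { isSemigroup = record
            { isMagma = record { isEquivalence = isEquivalence ; ∙-cong = cong₂ _ }
            ; assoc = λ _ _ _ → cong₂ _,_ (𝔾.+-assoc _ _ _) (ℍ.+-assoc _ _ _) }
          ; identity = (λ _ → cong₂ _,_ (𝔾.+-identityˡ _) (ℍ.+-identityˡ _))
                     , (λ _ → cong₂ _,_ (𝔾.+-identityʳ _) (ℍ.+-identityʳ _)) }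
        ; inverse = (λ _ → cong₂ _,_ (𝔾.+-inverseˡ _) (ℍ.+-inverseˡ _))
                  , (λ _ → cong₂ _,_ (𝔾.+-inverseʳ _) (ℍ.+-inverseʳ _))
        ; ⁻¹-cong = cong neg }
      ; comm = λ _ _ → cong₂ _,_ (𝔾.+-comm _ _) (ℍ.+-comm _ _) } }
    where
    module 𝔾 = FiniteAbelianGroup 𝔾
    module ℍ = FiniteAbelianGroup ℍ
    neg : 𝔾.G × ℍ.G → 𝔾.G × ℍ.G
    neg (g , h) = 𝔾.- g , ℍ.- h

  module ProductOrders {u v} (𝔾 : FiniteAbelianGroup u) (ℍ : FiniteAbelianGroup v) where
    private
      module 𝔾 = FiniteAbelianGroup 𝔾
      module ℍ = FiniteAbelianGroup ℍ
      module 𝔾ᵒ = Orders 𝔾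
      module ℍᵒ = Orders ℍ
    open Orders (𝔾 ×ᴳ ℍ)

    multiple-× : ∀ q g h → q · (g , h) ≡ (q 𝔾ᵒ.· g , q ℍᵒ.· h)
    multiple-× zero g h = refl
    multiple-× (suc q) g h = cong (FiniteAbelianGroup._+_ (𝔾 ×ᴳ ℍ) (g , h)) (multiple-× q g h)

    -- L is the least common multiple of k and ℓ, given by its universal property.
    order-× : ∀ {k ℓ L g h} → 𝔾ᵒ.HasOrder k g → ℍᵒ.HasOrder ℓ h →
      (∀ {q} → k ∣ q → ℓ ∣ q → L ∣ q) → k ∣ L → ℓ ∣ L → HasOrder L (g , h)
    order-× {g = g} {h} ord-g ord-h lcm k∣L ℓ∣L q =
      (λ eq → let eq′ = trans (sym (multiple-× q g h)) eq in
        lcm (proj₁ (ord-g q) (cong proj₁ eq′)) (proj₁ (ord-h q) (cong proj₂ eq′))) ,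
      (λ L∣q → trans (multiple-× q g h)
        (cong₂ _,_ (proj₂ (ord-g q) (ℕ.∣-trans k∣L L∣q)) (proj₂ (ord-h q) (ℕ.∣-trans ℓ∣L L∣q))))

  module CyclicPieces (m : ℕ) .{{_ : NonZero m}} where
    open Residues m
    open FiniteAbelianGroup residues using (sum)
    open Orders residues

    -- For ℓ p = m, the residue of c p has order ℓ if c is coprime to ℓ; below c ∈ {1, -1, -2}.
    module _ (ℓ p : ℕ) .{{_ : NonZero p}} (m≡ℓp : m ≡ ℓ ℕ.* p) where
      element : ℤ → Fin m
      element c = ⟦ c ℤ.* + p ⟧

      m≡ℓp′ : + m ≡ + ℓ ℤ.* + p
      m≡ℓp′ = trans (cong +_ m≡ℓp) (ℤ.pos-* ℓ p)

      -- ℓ p divides q c p exactly when ℓ divides q c; `coprime` is coprimality of c and ℓ in the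
      -- form applied here.
      element-order : ∀ c → (∀ q → + ℓ ∣ᶻ q ℤ.* c → + ℓ ∣ᶻ q) → HasOrder ℓ (element c)
      element-order c coprime q = order⇒ , order⇐
        where
        order⇒ : q · element c ≡ ⟦ 0ℤ ⟧ → ℓ ∣ q
        order⇒ eq = ∣⇒∣ᵤ (coprime (+ q) (*-cancelʳ-∣ (+ p) (subst₂ _∣ᶻ_ m≡ℓp′
          (trans (ℤ.+-identityʳ _) (sym (ℤ.*-assoc (+ q) c (+ p))))
          (⟦⟧-injective (+ q ℤ.* (c ℤ.* + p)) 0ℤ (trans (sym (multiple-⟦⟧ q (c ℤ.* + p))) eq)))))
        order⇐ : ℓ ∣ q → q · element c ≡ ⟦ 0ℤ ⟧
        order⇐ (ℕ.divides k q≡kℓ) = trans (multiple-⟦⟧ q (c ℤ.* + p)) (⟦⟧-cong (+ q ℤ.* (c ℤ.* + p)) 0ℤ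
          (divides (+ k ℤ.* c) (begin
            + q ℤ.* (c ℤ.* + p) ℤ.+ 0ℤ     ≡⟨ cong (λ z → z ℤ.* (c ℤ.* + p) ℤ.+ 0ℤ) (trans (cong +_ q≡kℓ) (ℤ.pos-* k ℓ)) ⟩
            + k ℤ.* + ℓ ℤ.* (c ℤ.* + p) ℤ.+ 0ℤ ≡⟨ solve 4 (λ k ℓ c p → k :* ℓ :* (c :* p) :+ con 0ℤ := k :* c :* (ℓ :* p)) refl (+ k) (+ ℓ) c (+ p) ⟩
            + k ℤ.* c ℤ.* (+ ℓ ℤ.* + p)    ≡⟨ cong (λ z → + k ℤ.* c ℤ.* z) m≡ℓp′ ⟨
            + k ℤ.* c ℤ.* + m ∎)))
          where open ≡-Reasoning

      order-1 : HasOrder ℓ (element 1ℤ)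
      order-1 = element-order 1ℤ λ q → subst (+ ℓ ∣ᶻ_) (ℤ.*-identityʳ q)

      order-neg-1 : HasOrder ℓ (element (ℤ.- 1ℤ))
      order-neg-1 = element-order (ℤ.- 1ℤ) λ q ℓ∣-q →
        subst (+ ℓ ∣ᶻ_) (solve 1 (λ q → :- (q :* (:- con 1ℤ)) := q) refl q) (∣m⇒∣-m ℓ∣-q)

      order-neg-2 : IsOdd ℓ → HasOrder ℓ (element (ℤ.- + 2))
      order-neg-2 odd = element-order (ℤ.- + 2) λ q ℓ∣-2q → odd-∣2* odd q
        (subst (+ ℓ ∣ᶻ_) (solve 1 (λ q → :- (q :* (:- con (+ 2))) := con (+ 2) :* q) refl q) (∣m⇒∣-m ℓ∣-2q))

      element-+ : ∀ c d → element c ⊕ element d ≡ element (c ℤ.+ d)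
      element-+ c d = trans (⟦+⟧ (c ℤ.* + p) (d ℤ.* + p)) (cong ⟦_⟧ (sym (ℤ.*-distribʳ-+ (+ p) c d)))

      cyclic-pieces : IsOdd ℓ → ZeroSumPieces (HasOrder ℓ)
      cyclic-pieces odd = record
        { pair = pair ; pair-ok = λ { zero → order-1 ; (suc zero) → order-neg-1 }
        ; pair-sum = trans (cong (element 1ℤ ⊕_) (element-+ (ℤ.- 1ℤ) 0ℤ)) (element-+ 1ℤ (ℤ.- 1ℤ))
        ; triple = triple
        ; triple-ok = λ { zero → order-1 ; (suc zero) → order-1 ; (suc (suc zero)) → order-neg-2 odd }
        ; triple-sum = trans (cong (λ z → element 1ℤ ⊕ (element 1ℤ ⊕ z)) (element-+ (ℤ.- + 2) 0ℤ))
            (trans (cong (element 1ℤ ⊕_) (element-+ 1ℤ (ℤ.- + 2))) (element-+ 1ℤ (ℤ.- 1ℤ))) }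
        where
        pair : Fin 2 → Fin m
        pair zero = element 1ℤ
        pair (suc zero) = element (ℤ.- 1ℤ)
        triple : Fin 3 → Fin m
        triple zero = element 1ℤ
        triple (suc zero) = element 1ℤ
        triple (suc (suc zero)) = element (ℤ.- + 2)

    -- A fixed point a of negation satisfies m ∣ 2a, hence m ∣ a because m is odd.
    negation : IsOdd m → FixedPointFreeAutomorphism
    negation odd = record
      { φ = mk↔ₛ′ ⊖_ ⊖_ involutive involutive
      ; φ-homo = ⟦⟧-surjective _ λ a → ⟦⟧-surjective _ λ b →
          trans (cong ⊖_ (⟦+⟧ a b)) (trans (⟦-⟧ (a ℤ.+ b)) (trans (cong ⟦_⟧ (ℤ.neg-distrib-+ a b))
            (sym (trans (cong₂ _⊕_ (⟦-⟧ a) (⟦-⟧ b)) (⟦+⟧ (ℤ.- a) (ℤ.- b))))))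
      ; φ-fixed = ⟦⟧-surjective _ λ a -a≡a → ⟦⟧-cong a 0ℤ (subst (+ m ∣ᶻ_) (sym (ℤ.+-identityʳ a))
          (odd-∣2* odd a (subst (+ m ∣ᶻ_) (solve 1 (λ a → :- (:- a :- a) := con (+ 2) :* a) refl a)
            (∣m⇒∣-m (⟦⟧-injective (ℤ.- a) a (trans (sym (⟦-⟧ a)) -a≡a)))))) }
      where
      involutive : ∀ x → ⊖ (⊖ x) ≡ x
      involutive = ⟦⟧-surjective _ λ a → trans (cong ⊖_ (⟦-⟧ a)) (trans (⟦-⟧ (ℤ.- a)) (cong ⟦_⟧ (ℤ.neg-involutive a)))

open ElementOrders

-- The group ℤ₂² × ℤ_m

module KleinGroup where
  open import Data.Fin.Properties using (all?) renaming (_≟_ to _≟ᶠ_)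
  import Data.Nat.Divisibility as ℕ
  open import Relation.Nullary.Decidable using (toWitness)

  module _ {u v} (𝔾 : FiniteAbelianGroup u) (ℍ : FiniteAbelianGroup v) where
    private
      module 𝔾 = FiniteAbelianGroup 𝔾
      module ℍ = FiniteAbelianGroup ℍ
      module 𝔾ᵒ = Orders 𝔾
      module ℍᵒ = Orders ℍ
    open Orders (𝔾 ×ᴳ ℍ)

    sum-× : ∀ {n} (f : Fin n → 𝔾.G) (g : Fin n → ℍ.G) →
      FiniteAbelianGroup.sum (𝔾 ×ᴳ ℍ) (λ i → f i , g i) ≡ (𝔾.sum f , ℍ.sum g)
    sum-× {zero} f g = refl
    sum-× {suc n} f g = cong (FiniteAbelianGroup._+_ (𝔾 ×ᴳ ℍ) (f zero , g zero)) (sum-× (f ∘ suc) (g ∘ suc))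

    product-pieces : ∀ {P Q R} → 𝔾ᵒ.ZeroSumPieces P → ℍᵒ.ZeroSumPieces Q → (∀ {g h} → P g → Q h → R (g , h)) → ZeroSumPieces R
    product-pieces p q r = record
      { pair = λ i → p.pair i , q.pair i
      ; pair-ok = λ i → r (p.pair-ok i) (q.pair-ok i)
      ; pair-sum = trans (sum-× p.pair q.pair) (cong₂ _,_ p.pair-sum q.pair-sum)
      ; triple = λ i → p.triple i , q.triple i
      ; triple-ok = λ i → r (p.triple-ok i) (q.triple-ok i)
      ; triple-sum = trans (sum-× p.triple q.triple) (cong₂ _,_ p.triple-sum q.triple-sum) }
      where
      module p = 𝔾ᵒ.ZeroSumPieces p
      module q = ℍᵒ.ZeroSumPieces q

    product-automorphism : 𝔾ᵒ.FixedPointFreeAutomorphism → ℍᵒ.FixedPointFreeAutomorphism → FixedPointFreeAutomorphism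
    product-automorphism A B = record
      { φ = A.φ ×-↔ B.φ
      ; φ-homo = λ (g , h) (g′ , h′) → cong₂ _,_ (A.φ-homo g g′) (B.φ-homo h h′)
      ; φ-fixed = λ (g , h) eq → cong₂ _,_ (A.φ-fixed g (cong proj₁ eq)) (B.φ-fixed h (cong proj₂ eq)) }
      where
      module A = 𝔾ᵒ.FixedPointFreeAutomorphism A
      module B = ℍᵒ.FixedPointFreeAutomorphism B

  ℤ₂ : FiniteAbelianGroup 2
  ℤ₂ = Residues.residues 2

  V₄ : FiniteAbelianGroup 4
  V₄ = ℤ₂ ×ᴳ ℤ₂

  module V₄ᵒ = Orders V₄

  -- Multiplication by a primitive element of the field with four elements; it permutes the three
  -- involutions cyclically. Negation is the identity here and would not do.
  V₄-automorphism : V₄ᵒ.FixedPointFreeAutomorphism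
  V₄-automorphism = record
    { φ = mk↔ₛ′ φ φ⁻¹ (λ (a , b) → inv a b) (λ (a , b) → inv′ a b)
    ; φ-homo = λ (a , b) (c , d) → homo a b c d
    ; φ-fixed = λ (a , b) → fixed a b }
    where
    open FiniteAbelianGroup ℤ₂ using (_+_)
    φ φ⁻¹ : Fin 2 × Fin 2 → Fin 2 × Fin 2
    φ (a , b) = b , a + b
    φ⁻¹ (a , b) = a + b , a
    inv : ∀ a b → φ (φ⁻¹ (a , b)) ≡ (a , b)
    inv zero zero = refl
    inv zero (suc zero) = refl
    inv (suc zero) zero = refl
    inv (suc zero) (suc zero) = refl
    inv′ : ∀ a b → φ⁻¹ (φ (a , b)) ≡ (a , b)
    inv′ zero zero = refl
    inv′ zero (suc zero) = refl
    inv′ (suc zero) zero = refl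
    inv′ (suc zero) (suc zero) = refl
    homo : ∀ a b c d → φ (a + c , b + d) ≡ (b + d , (a + b) + (c + d))
    homo a b c d = cong (b + d ,_) (toWitness {a? = all? λ a → all? λ b → all? λ c → all? λ d →
      ((a + c) + (b + d)) ≟ᶠ ((a + b) + (c + d))} _ a b c d)
    fixed : ∀ a b → φ (a , b) ≡ (a , b) → (a , b) ≡ (zero , zero)
    fixed zero zero _ = refl
    fixed (suc zero) (suc zero) ()

  V₄-involutions : V₄ᵒ.ZeroSumPieces (V₄ᵒ.HasOrder 2)
  V₄-involutions = record
    { pair = λ _ → e₁ ; pair-ok = λ _ → e₁-order ; pair-sum = refl
    ; triple = λ { zero → e₁ ; (suc zero) → e₂ ; (suc (suc zero)) → e₃ }
    ; triple-ok = λ { zero → e₁-order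
                    ; (suc zero) → V₄ᵒ.involution-order e₂ (λ ()) refl
                    ; (suc (suc zero)) → V₄ᵒ.involution-order e₃ (λ ()) refl }
    ; triple-sum = refl }
    where
    e₁ e₂ e₃ : Fin 2 × Fin 2
    e₁ = suc zero , zero
    e₂ = zero , suc zero
    e₃ = suc zero , suc zero
    e₁-order : V₄ᵒ.HasOrder 2 e₁
    e₁-order = V₄ᵒ.involution-order e₁ (λ ()) refl

  zero-pieces : ∀ {u} (𝔾 : FiniteAbelianGroup u) → Orders.ZeroSumPieces 𝔾 (Orders.HasOrder 𝔾 1)
  zero-pieces 𝔾 = record
    { pair = proj₁ (zero-sum-0# 2) ; pair-ok = proj₁ (proj₂ (zero-sum-0# 2)) ; pair-sum = proj₂ (proj₂ (zero-sum-0# 2))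
    ; triple = proj₁ (zero-sum-0# 3) ; triple-ok = proj₁ (proj₂ (zero-sum-0# 3)) ; triple-sum = proj₂ (proj₂ (zero-sum-0# 3)) }
    where open Orders 𝔾

  module KleinTimesCyclic (m : ℕ) .{{_ : NonZero m}} where
    ℤₘ : FiniteAbelianGroup m
    ℤₘ = Residues.residues m

    group : FiniteAbelianGroup (4 ℕ.* m)
    group = V₄ ×ᴳ ℤₘ

    open Orders group

    automorphism : IsOdd m → FixedPointFreeAutomorphism
    automorphism odd = product-automorphism V₄ ℤₘ V₄-automorphism (CyclicPieces.negation m odd)

    odd-pieces : ∀ ℓ p .{{_ : NonZero p}} → m ≡ ℓ ℕ.* p → IsOdd ℓ → ZeroSumPieces (HasOrder ℓ)
    odd-pieces ℓ p m≡ℓp odd = product-pieces V₄ ℤₘ (zero-pieces V₄) (CyclicPieces.cyclic-pieces m ℓ p m≡ℓp odd)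
      λ g h → ProductOrders.order-× V₄ ℤₘ g h (λ _ ℓ∣q → ℓ∣q) (ℕ.1∣ ℓ) ℕ.∣-refl

    -- The components have orders 2 and ℓ, and ℓ is odd, so their least common multiple is 2ℓ.
    even-pieces : ∀ ℓ p .{{_ : NonZero p}} → m ≡ ℓ ℕ.* p → IsOdd ℓ → ZeroSumPieces (HasOrder (2 ℕ.* ℓ))
    even-pieces ℓ p m≡ℓp odd = product-pieces V₄ ℤₘ V₄-involutions (CyclicPieces.cyclic-pieces m ℓ p m≡ℓp odd)
      λ g h → ProductOrders.order-× V₄ ℤₘ g h (2∣∧odd∣⇒2*∣ odd) (ℕ.m∣m*n ℓ) (ℕ.n∣m*n 2)

open KleinGroup

-- From permutations between consecutive parts to cycle factors

module CycleFactors where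
  open import Defs
  open import Data.Fin.Properties using (any?; *↔×; toℕ-injective; toℕ-fromℕ<; toℕ<n; toℕ-fromℕ) renaming (_≟_ to _≟ᶠ_)
  open import Data.Nat using (_+_; _*_; _∸_; _<?_; _≟_)
  open import Data.Nat.DivMod using (_/_; _%_; m≡m%n+[m/n]*n; m%n<n)
  open import Data.Nat.Divisibility as ℕ using (_∣_)
  open import Data.Product.Properties using (≡-dec)
  open import Relation.Binary using (DecidableEquality)

  iter : ∀ {A : Set} → (A → A) → ℕ → A → A
  iter f zero x = x
  iter f (suc j) x = f (iter f j x)

  iter-+ : ∀ {A : Set} (f : A → A) i j x → iter f (i + j) x ≡ iter f i (iter f j x)
  iter-+ f zero j x = refl
  iter-+ f (suc i) j x = cong f (iter-+ f i j x)

  iter-comm : ∀ {A : Set} (f : A → A) j x → iter f j (f x) ≡ f (iter f j x)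
  iter-comm f zero x = refl
  iter-comm f (suc j) x = cong f (iter-comm f j x)

  iter-fixed : ∀ {A : Set} (f : A → A) L {x} → iter f L x ≡ x → ∀ k → iter f (k * L) x ≡ x
  iter-fixed f L fix zero = refl
  iter-fixed f L fix (suc k) = trans (iter-+ f L (k * L) _) (trans (cong (iter f L) (iter-fixed f L fix k)) fix)

  record ExactPeriod {A : Set} (L : ℕ) (f : A → A) : Set where
    field
      period : ∀ x → iter f L x ≡ x
      exact : ∀ x j → iter f j x ≡ x → L ∣ j

  IsNext-unique : ∀ {n} {i j j′ : Fin n} → IsNext n i j → IsNext n i j′ → j ≡ j′
  IsNext-unique (inj₁ p) (inj₁ q) = toℕ-injective (trans (sym p) q)
  IsNext-unique {n} {j = j} (inj₁ p) (inj₂ (q , _)) = ⊥-elim (ℕ.<-irrefl (trans (sym p) q) (toℕ<n j))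
  IsNext-unique {n} {j′ = j′} (inj₂ (p , _)) (inj₁ q) = ⊥-elim (ℕ.<-irrefl (trans (sym q) p) (toℕ<n j′))
  IsNext-unique (inj₂ (_ , p)) (inj₂ (_ , q)) = toℕ-injective (trans p (sym q))

  IsNext-injective : ∀ {n} {i i′ j : Fin n} → IsNext n i j → IsNext n i′ j → i ≡ i′
  IsNext-injective (inj₁ p) (inj₁ q) = toℕ-injective (ℕ.suc-injective (trans p (sym q)))
  IsNext-injective (inj₁ p) (inj₂ (_ , q)) = ⊥-elim (ℕ.0≢1+n (trans (sym q) (sym p)))
  IsNext-injective (inj₂ (_ , p)) (inj₁ q) = ⊥-elim (ℕ.0≢1+n (trans (sym p) (sym q)))
  IsNext-injective (inj₂ (p , _)) (inj₂ (q , _)) = toℕ-injective (ℕ.suc-injective (trans p (sym q)))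

  -- With two parts each would be next to the other. From three parts on, every edge has one
  -- direction of travel, so it cannot be used by two factors in opposite directions.
  IsNext-asym : ∀ {n} {i j : Fin n} → 3 ≤ n → IsNext n i j → IsNext n j i → ⊥
  IsNext-asym {n} 3≤n (inj₁ p) (inj₁ q) = ℕ.<-asym (ℕ.≤-reflexive p) (ℕ.≤-reflexive q)
  IsNext-asym {n} 3≤n (inj₁ p) (inj₂ (q , r)) = ℕ.<⇒≱ 3≤n (ℕ.≤-reflexive (trans (sym q) (cong suc (trans (sym p) (cong suc r)))))
  IsNext-asym {n} 3≤n (inj₂ (p , r)) (inj₁ q) = ℕ.<⇒≱ 3≤n (ℕ.≤-reflexive (trans (sym p) (cong suc (trans (sym q) (cong suc r)))))
  IsNext-asym {n} 3≤n (inj₂ (_ , r)) (inj₂ (q , _)) = ℕ.<⇒≱ 3≤n (ℕ.≤-trans (ℕ.≤-reflexive (trans (sym q) (cong suc r))) (s≤s z≤n))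

  successor : ∀ {n} (i : Fin n) → ∃ (IsNext n i)
  successor {suc n} i with suc (toℕ i) <? suc n
  ... | yes i+1<n = fromℕ< i+1<n , inj₁ (sym (toℕ-fromℕ< i+1<n))
  ... | no i+1≮n = zero , inj₂ (ℕ.≤-antisym (toℕ<n i) (ℕ.≮⇒≥ i+1≮n) , refl)

  module OrbitFactor {v k L : ℕ} (3≤L : 3 ≤ L) (Φ : Vtx v k → Vtx v k)
    (Φ-adjacent : ∀ p → Adj v k p (Φ p)) (orbits : ExactPeriod L Φ) where
    open ExactPeriod orbits

    private
      instance
        L-nonZero : NonZero L
        L-nonZero = ℕ.>-nonZero (ℕ.≤-trans (s≤s z≤n) 3≤L)

    _≟ᵛ_ : DecidableEquality (Vtx v k)
    _≟ᵛ_ = ≡-dec _≟ᶠ_ _≟ᶠ_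

    vertex : Fin (v * k) → Vtx v k
    vertex = to *↔×

    reduce : ∀ t x → ∃ λ (t′ : Fin L) → iter Φ (toℕ t′) x ≡ iter Φ t x
    reduce t x = fromℕ< (m%n<n t L) , (begin
        iter Φ (toℕ (fromℕ< (m%n<n t L))) x    ≡⟨ cong (λ j → iter Φ j x) (toℕ-fromℕ< (m%n<n t L)) ⟩
        iter Φ (t % L) x                       ≡⟨ cong (iter Φ (t % L)) (iter-fixed Φ L (period x) (t / L)) ⟨
        iter Φ (t % L) (iter Φ (t / L * L) x)  ≡⟨ iter-+ Φ (t % L) (t / L * L) x ⟨
        iter Φ (t % L + t / L * L) x           ≡⟨ cong (λ j → iter Φ j x) (m≡m%n+[m/n]*n t L) ⟨
        iter Φ t x                             ∎)
      where open ≡-Reasoning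

    -- As Φ to the power L is the identity, the power t (L - 1) undoes the power t; reachability is
    -- therefore symmetric.
    return : ∀ t {x y} → iter Φ t x ≡ y → ∃ λ t′ → iter Φ t′ y ≡ x
    return t {x} {y} eq = t * (L ∸ 1) , (begin
        iter Φ (t * (L ∸ 1)) y            ≡⟨ cong (iter Φ (t * (L ∸ 1))) eq ⟨
        iter Φ (t * (L ∸ 1)) (iter Φ t x) ≡⟨ iter-+ Φ (t * (L ∸ 1)) t x ⟨
        iter Φ (t * (L ∸ 1) + t) x        ≡⟨ cong (λ j → iter Φ j x) lemma ⟩
        iter Φ (t * L) x                  ≡⟨ iter-fixed Φ L (period x) t ⟩
        x                                 ∎)
      where
      open ≡-Reasoning
      lemma : t * (L ∸ 1) + t ≡ t * L
      lemma = trans (ℕ.+-comm _ t) (trans (sym (ℕ.*-suc t (L ∸ 1))) (cong (t *_) (ℕ.m+[n∸m]≡n (ℕ.>-nonZero⁻¹ L))))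

    same-position : ∀ x (t t′ : Fin L) → toℕ t ≤ toℕ t′ → iter Φ (toℕ t) x ≡ iter Φ (toℕ t′) x → t ≡ t′
    same-position x t t′ t≤t′ eq with toℕ t′ ∸ toℕ t in gap
    ... | zero = toℕ-injective (ℕ.≤-antisym t≤t′ (ℕ.m∸n≡0⇒m≤n gap))
    ... | suc e = ⊥-elim (ℕ.<⇒≱ (ℕ.≤-<-trans (subst (_≤ toℕ t′) gap (ℕ.m∸n≤m (toℕ t′) (toℕ t))) (toℕ<n t′))
        (ℕ.∣⇒≤ (exact (iter Φ (toℕ t) x) (suc e) (begin
          iter Φ (suc e) (iter Φ (toℕ t) x)  ≡⟨ iter-+ Φ (suc e) (toℕ t) x ⟨
          iter Φ (suc e + toℕ t) x           ≡⟨ cong (λ j → iter Φ (j + toℕ t) x) gap ⟨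
          iter Φ (toℕ t′ ∸ toℕ t + toℕ t) x  ≡⟨ cong (λ j → iter Φ j x) (ℕ.m∸n+n≡m t≤t′) ⟩
          iter Φ (toℕ t′) x                  ≡⟨ eq ⟨
          iter Φ (toℕ t) x                   ∎))))
      where open ≡-Reasoning

    -- One representative per orbit met among the first N vertices. `distinct` allows every t, not
    -- only t < L, so that times can be added before it is applied.
    record Representatives (N : ℕ) : Set where
      field
        count : ℕ
        rep : Fin count → Vtx v k
        distinct : ∀ c c′ t → iter Φ t (rep c) ≡ rep c′ → c ≡ c′
        covers : ∀ i → toℕ i < N → ∃ λ c → ∃ λ (t : Fin L) → iter Φ (toℕ t) (rep c) ≡ vertex i
    open Representatives

    representatives : ∀ N → N ≤ v * k → Representatives N
    representatives zero _ = record { count = 0 ; rep = λ () ; distinct = λ () ; covers = λ _ () }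
    representatives (suc N) N<vk = extend (any? λ c → any? λ t → iter Φ (toℕ t) (rep old c) ≟ᵛ x)
      where
      old : Representatives N
      old = representatives N (ℕ.<⇒≤ N<vk)
      x : Vtx v k
      x = vertex (fromℕ< N<vk)
      covers-new : ∀ {m} (r : Fin m → Vtx v k) →
        (∀ i → toℕ i < N → ∃ λ c → ∃ λ (t : Fin L) → iter Φ (toℕ t) (r c) ≡ vertex i) →
        (∃ λ c → ∃ λ (t : Fin L) → iter Φ (toℕ t) (r c) ≡ x) →
        ∀ i → toℕ i < suc N → ∃ λ c → ∃ λ (t : Fin L) → iter Φ (toℕ t) (r c) ≡ vertex i
      covers-new r old-covered (c , t , eq) i i<1+N with toℕ i ≟ N
      ... | yes i≡N = c , t , trans eq (cong vertex (toℕ-injective (trans (toℕ-fromℕ< N<vk) (sym i≡N))))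
      ... | no i≢N = old-covered i (ℕ.≤∧≢⇒< (ℕ.≤-pred i<1+N) i≢N)
      extend : Dec (∃ λ c → ∃ λ (t : Fin L) → iter Φ (toℕ t) (rep old c) ≡ x) → Representatives (suc N)
      extend (yes x-covered) = record
        { count = count old ; rep = rep old ; distinct = distinct old
        ; covers = covers-new (rep old) (covers old) x-covered }
      extend (no ¬x-covered) = record
        { count = suc (count old) ; rep = rep′ ; distinct = distinct′
        ; covers = covers-new rep′
            (λ i i<N → let c , t , eq = covers old i i<N in suc c , t , eq)
            (let t , eq = reduce 0 x in zero , t , eq) }
        where
        rep′ : Fin (suc (count old)) → Vtx v k
        rep′ zero = x
        rep′ (suc c) = rep old c
        not-reached : ∀ c t → iter Φ t (rep old c) ≢ x
        not-reached c t eq = let t′ , eq′ = reduce t (rep old c) in ¬x-covered (c , t′ , trans eq′ eq)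
        distinct′ : ∀ c c′ t → iter Φ t (rep′ c) ≡ rep′ c′ → c ≡ c′
        distinct′ zero zero t _ = refl
        distinct′ zero (suc c′) t eq = let t′ , eq′ = return t eq in ⊥-elim (not-reached c′ t′ eq′)
        distinct′ (suc c) zero t eq = ⊥-elim (not-reached c t eq)
        distinct′ (suc c) (suc c′) t eq = cong suc (distinct old c c′ t eq)

    private
      reps = representatives (v * k) ℕ.≤-refl

      Vert : Fin (count reps) → Fin L → Vtx v k
      Vert c t = iter Φ (toℕ t) (rep reps c)

      Vert-next : ∀ c t t′ → IsNext L t t′ → Φ (Vert c t) ≡ Vert c t′
      Vert-next c t t′ (inj₁ t+1≡t′) = cong (λ j → iter Φ j (rep reps c)) t+1≡t′
      Vert-next c t t′ (inj₂ (t+1≡L , t′≡0)) = begin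
        iter Φ (suc (toℕ t)) (rep reps c) ≡⟨ cong (λ j → iter Φ j (rep reps c)) t+1≡L ⟩
        iter Φ L (rep reps c)             ≡⟨ period _ ⟩
        rep reps c                        ≡⟨ cong (λ j → iter Φ j (rep reps c)) t′≡0 ⟨
        iter Φ (toℕ t′) (rep reps c)      ∎
        where open ≡-Reasoning

      Vert-injective : ∀ c t c′ t′ → Vert c t ≡ Vert c′ t′ → (c , t) ≡ (c′ , t′)
      Vert-injective c t c′ t′ eq with return (toℕ t′) {rep reps c′} refl
      ... | e , eq′ with distinct reps c c′ (e + toℕ t)
                           (trans (iter-+ Φ e (toℕ t) _) (trans (cong (iter Φ e) eq) eq′))
      ... | refl with ℕ.≤-total (toℕ t) (toℕ t′)
      ... | inj₁ t≤t′ = cong (c ,_) (same-position (rep reps c) t t′ t≤t′ eq)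
      ... | inj₂ t′≤t = cong (c ,_) (sym (same-position (rep reps c) t′ t t′≤t (sym eq)))

      position : ∀ p → ∃ λ c → ∃ λ t → Vert c t ≡ p
      position p = let c , t , eq = covers reps (from *↔× p) (toℕ<n _) in c , t , trans eq (strictlyInverseˡ *↔× p)

    factor : CFactor v k L
    factor = record
      { len≥3 = 3≤L
      ; m = count reps
      ; vert = Vert
      ; edgesOk = λ c t t′ next → subst (Adj v k (Vert c t)) (Vert-next c t t′ next) (Φ-adjacent (Vert c t))
      ; cover = λ p → let c , t , eq = position p in
          (c , t) , eq , λ {(c′ , t′)} eq′ → Vert-injective c t c′ t′ (trans eq (sym eq′)) }

    edge⇒ : ∀ {p q} → DEdgeIn factor p q → Φ p ≡ q
    edge⇒ (c , t , t′ , next , refl , refl) = Vert-next c t t′ next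

    edge⇐ : ∀ {p q} → Φ p ≡ q → DEdgeIn factor p q
    edge⇐ {p} {q} Φp≡q =
      let c , t , eq = position p
          t′ , next = successor t
      in c , t , t′ , next , eq , trans (sym (Vert-next c t t′ next)) (trans (cong Φ eq) Φp≡q)

  module Layered {v n′ : ℕ} (step : ℕ → Fin v → Fin v)
    (step-injective : ∀ i {y y′} → step i y ≡ step i y′ → y ≡ y′) where

    private
      n : ℕ
      n = suc n′

    next : Fin n → Fin n
    next i = proj₁ (successor i)

    Φ : Vtx v n → Vtx v n
    Φ (y , i) = step (toℕ i) y , next i

    Φ-adjacent : ∀ p → Adj v n p (Φ p)
    Φ-adjacent (y , i) = inj₁ (proj₂ (successor i))

    Φ-injective : ∀ p q → Φ p ≡ Φ q → p ≡ q
    Φ-injective (y , i) (y′ , i′) eq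
      with IsNext-injective (proj₂ (successor i)) (subst (IsNext n i′) (sym (cong proj₂ eq)) (proj₂ (successor i′)))
    ... | refl = cong (_, i) (step-injective (toℕ i) (cong proj₁ eq))

    around : ℕ → Fin v → Fin v
    around zero y = y
    around (suc j) y = step j (around j y)

    iter-Φ : ∀ j (i : Fin n) → toℕ i ≡ j → ∀ y → iter Φ j (y , zero) ≡ (around j y , i)
    iter-Φ zero i i≡0 y = cong (y ,_) (sym (toℕ-injective i≡0))
    iter-Φ (suc j) i i≡1+j y =
      trans (cong Φ (iter-Φ j i⁻ (toℕ-fromℕ< j<n) y))
        (cong₂ _,_ (cong (λ e → step e (around j y)) (toℕ-fromℕ< j<n))
          (IsNext-unique (proj₂ (successor i⁻)) (inj₁ (trans (cong suc (toℕ-fromℕ< j<n)) (sym i≡1+j)))))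
      where
      j<n : j < n
      j<n = ℕ.<⇒≤ (subst (_< n) i≡1+j (toℕ<n i))
      i⁻ = fromℕ< j<n

    iter-Φ-n : ∀ y → iter Φ n (y , zero) ≡ (around n y , zero)
    iter-Φ-n y = trans (cong Φ (iter-Φ n′ (fromℕ n′) (toℕ-fromℕ n′) y))
      (cong₂ _,_ (cong (λ e → step e (around n′ y)) (toℕ-fromℕ n′))
        (IsNext-unique (proj₂ (successor (fromℕ n′))) (inj₂ (cong suc (toℕ-fromℕ n′) , refl))))

    iter-Φ-qn : ∀ q y → iter Φ (q * n) (y , zero) ≡ (iter (around n) q y , zero)
    iter-Φ-qn zero y = refl
    iter-Φ-qn (suc q) y = trans (iter-+ Φ n (q * n) _) (trans (cong (iter Φ n) (iter-Φ-qn q y)) (iter-Φ-n _))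

    module _ {ℓ : ℕ} (turns : ExactPeriod ℓ (around n)) where
      open ExactPeriod turns

      ExactAt : Vtx v n → Set
      ExactAt p = iter Φ (ℓ * n) p ≡ p × (∀ j → iter Φ j p ≡ p → ℓ * n ∣ j)

      -- A walk from part 0 can only return after a whole number q of turns, and then the composite
      -- around the circle has been applied q times.
      exact-zero : ∀ y → ExactAt (y , zero)
      exact-zero y = trans (iter-Φ-qn ℓ y) (cong (_, zero) (period y)) , λ j eq → returns j eq
        where
        returns : ∀ j → iter Φ j (y , zero) ≡ (y , zero) → ℓ * n ∣ j
        returns j eq = subst (ℓ * n ∣_) (sym j≡qn)
            (ℕ.*-monoˡ-∣ n (exact y q (cong proj₁ (trans (sym (iter-Φ-qn q y)) (trans (cong (λ j → iter Φ j (y , zero)) (sym j≡qn)) eq)))))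
          where
          q = j / n
          i = fromℕ< (m%n<n j n)
          at : iter Φ j (y , zero) ≡ (around (j % n) (iter (around n) q y) , i)
          at = trans (cong (λ j → iter Φ j (y , zero)) (m≡m%n+[m/n]*n j n))
            (trans (iter-+ Φ (j % n) (q * n) (y , zero)) (trans (cong (iter Φ (j % n)) (iter-Φ-qn q y))
              (iter-Φ (j % n) i (toℕ-fromℕ< (m%n<n j n)) _)))
          j≡qn : j ≡ q * n
          j≡qn = trans (m≡m%n+[m/n]*n j n) (cong (_+ q * n)
            (trans (sym (toℕ-fromℕ< (m%n<n j n))) (cong toℕ (cong proj₂ (trans (sym at) eq)))))

      -- Φ commutes with its powers and is injective, so p and Φ p return at the same times.
      exact-back : ∀ p → ExactAt (Φ p) → ExactAt p
      exact-back p (fix , ret) =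
        Φ-injective _ _ (trans (sym (iter-comm Φ (ℓ * n) p)) fix) ,
        λ j eq → ret j (trans (iter-comm Φ j p) (cong Φ eq))

      -- The walk is followed forward to part 0: d steps lead from part i to the last part, and one
      -- more closes the circle.
      exact-at : ∀ d y i → toℕ i + d ≡ n′ → ExactAt (y , i)
      exact-at zero y i i≡n′ = exact-back (y , i) (subst (λ j → ExactAt (step (toℕ i) y , j))
        (IsNext-unique {j = zero} (inj₂ (cong suc (trans (sym (ℕ.+-identityʳ _)) i≡n′) , refl)) (proj₂ (successor i)))
        (exact-zero _))
      exact-at (suc d) y i i+1+d≡n′ = exact-back (y , i) (exact-at d _ (next i) (trans (cong (_+ d) (sym next≡)) (trans (sym (ℕ.+-suc (toℕ i) d)) i+1+d≡n′)))
        where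
        next≡ : suc (toℕ i) ≡ toℕ (next i)
        next≡ with successor i
        ... | _ , inj₁ eq = eq
        ... | _ , inj₂ (1+i≡n , _) = ⊥-elim (ℕ.m+1+n≢m (toℕ i) (trans i+1+d≡n′ (sym (ℕ.suc-injective 1+i≡n))))

      Φ-orbits : ExactPeriod (ℓ * n) Φ
      Φ-orbits = record { period = λ p → proj₁ (exact-any p) ; exact = λ p → proj₂ (exact-any p) }
        where
        exact-any : ∀ p → ExactAt p
        exact-any (y , i) = exact-at (n′ ∸ toℕ i) y i (ℕ.m+[n∸m]≡n (ℕ.≤-pred (toℕ<n i)))

  ∃!-map : ∀ {A : Set} {P Q : A → Set} → (∀ a → P a → Q a) → (∀ a → Q a → P a) → ∃! _≡_ P → ∃! _≡_ Q
  ∃!-map P⇒Q Q⇒P (a , pa , unique) = a , P⇒Q a pa , λ {b} qb → unique (Q⇒P b qb)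

  module _ {v n′ s r α β : ℕ} (3≤n : 3 ≤ suc n′) (1≤α : 1 ≤ α) (1≤β : 1 ≤ β)
    (step : Fin s ⊎ Fin r → ℕ → Fin v → Fin v)
    (step-injective : ∀ f i {y y′} → step f i y ≡ step f i y′ → y ≡ y′)
    (sharp : ∀ i y y′ → ∃! _≡_ λ f → step f i y ≡ y′)
    (α-turns : ∀ f → ExactPeriod α (Layered.around {n′ = n′} (step (inj₁ f)) (step-injective (inj₁ f)) (suc n′)))
    (β-turns : ∀ f → ExactPeriod β (Layered.around {n′ = n′} (step (inj₂ f)) (step-injective (inj₂ f)) (suc n′))) where

    private
      n : ℕ
      n = suc n′

      Φ : Fin s ⊎ Fin r → Vtx v n → Vtx v n
      Φ f = Layered.Φ (step f) (step-injective f)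

      long : ∀ {ℓ} → 1 ≤ ℓ → 3 ≤ ℓ * n
      long {ℓ} 1≤ℓ = ℕ.≤-trans 3≤n (subst (_≤ ℓ * n) (ℕ.*-identityˡ n) (ℕ.*-monoˡ-≤ n 1≤ℓ))

      module A f = OrbitFactor (long 1≤α) (Φ (inj₁ f)) (Layered.Φ-adjacent (step (inj₁ f)) (step-injective (inj₁ f)))
        (Layered.Φ-orbits (step (inj₁ f)) (step-injective (inj₁ f)) (α-turns f))
      module B f = OrbitFactor (long 1≤β) (Φ (inj₂ f)) (Layered.Φ-adjacent (step (inj₂ f)) (step-injective (inj₂ f)))
        (Layered.Φ-orbits (step (inj₂ f)) (step-injective (inj₂ f)) (β-turns f))

      unique-forward : ∀ p q → IsNext n (proj₂ p) (proj₂ q) → ∃! _≡_ λ f → Φ f p ≡ q ⊎ Φ f q ≡ p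
      unique-forward (y , i) (y′ , j) i→j = ∃!-map
        (λ f eq → inj₁ (cong₂ _,_ eq (IsNext-unique (proj₂ (successor i)) i→j)))
        (λ { f (inj₁ eq) → cong proj₁ eq
           -- The factors run forward only, and q already lies in the part after p.
           ; f (inj₂ eq) → ⊥-elim (IsNext-asym 3≤n i→j (subst (IsNext n j) (cong proj₂ eq) (proj₂ (successor j)))) })
        (sharp (toℕ i) y y′)

      unique-factor : ∀ p q → Adj v n p q → ∃! _≡_ λ f → Φ f p ≡ q ⊎ Φ f q ≡ p
      unique-factor p q (inj₁ i→j) = unique-forward p q i→j
      unique-factor p q (inj₂ j→i) = ∃!-map (λ f → swap) (λ f → swap) (unique-forward q p j→i)

    layered-decomposition : Decomp v (suc n′) s (α * suc n′) r (β * suc n′)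
    layered-decomposition = A.factor , B.factor , λ p q adj → ∃!-map
      (λ { (inj₁ f) → map (A.edge⇐ f) (A.edge⇐ f) ; (inj₂ f) → map (B.edge⇐ f) (B.edge⇐ f) })
      (λ { (inj₁ f) → map (A.edge⇒ f) (A.edge⇒ f) ; (inj₂ f) → map (B.edge⇒ f) (B.edge⇒ f) })
      (unique-factor p q adj)

open CycleFactors

-- Layers built from a design and three bijections

module LatinSquareFactors where
  open import Defs
  open import Data.Fin.Properties using (*↔×)
  import Data.Nat.Divisibility as ℕ

  ∃!-bijection : ∀ {A B : Set} (f : A ↔ B) {P : B → Set} → ∃! _≡_ (P ∘ to f) → ∃! _≡_ P
  ∃!-bijection f {P} (a , pa , unique) = to f a , pa , λ {b} pb →
    trans (cong (to f) (unique (subst P (sym (strictlyInverseˡ f b)) pb))) (strictlyInverseˡ f b)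

  -- The block through (∞ , f) and (i , h) carries h from group i to group j; for fixed f these
  -- transition maps compose, and for fixed h their values are distinct.
  module Transitions {k : ℕ} {W : Set} (D : TD k W) (∞ : Fin k) where
    open TransversalDesign D

    module _ {i} (∞≢i : ∞ ≢ i) where
      through : W → W → Block
      through f h = proj₁ (line ∞≢i f h)

      τ : Fin k → W → W → W
      τ j f h = pt (through f h) j

      τ-unique : ∀ b l → τ l (pt b ∞) (pt b i) ≡ pt b l
      τ-unique b l = let _ , eq∞ , eqᵢ = line ∞≢i (pt b ∞) (pt b i) in agree ∞≢i _ b eq∞ eqᵢ l

      τ-same : ∀ f h → τ i f h ≡ h
      τ-same f h = proj₂ (proj₂ (line ∞≢i f h))

    -- The block through (∞ , f) and (i , h) also passes through the intermediate point in group j.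
    τ-compose : ∀ {i j} (∞≢i : ∞ ≢ i) (∞≢j : ∞ ≢ j) l f h → τ ∞≢j l f (τ ∞≢i j f h) ≡ τ ∞≢i l f h
    τ-compose ∞≢i ∞≢j l f h = trans
      (cong (λ f → τ ∞≢j l f (τ ∞≢i _ _ h)) (sym (proj₁ (proj₂ (line ∞≢i f h))))) (τ-unique ∞≢j (through ∞≢i f h) l)

    τ-inverse : ∀ {i j} (∞≢i : ∞ ≢ i) (∞≢j : ∞ ≢ j) f h → τ ∞≢j i f (τ ∞≢i j f h) ≡ h
    τ-inverse {i} ∞≢i ∞≢j f h = trans (τ-compose ∞≢i ∞≢j i f h) (τ-same ∞≢i f h)

    τ-injective : ∀ {i j} (∞≢i : ∞ ≢ i) (∞≢j : ∞ ≢ j) f {h h′} → τ ∞≢i j f h ≡ τ ∞≢i j f h′ → h ≡ h′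
    τ-injective ∞≢i ∞≢j f {h} {h′} eq = trans (sym (τ-inverse ∞≢i ∞≢j f h)) (trans (cong (τ ∞≢j _ f) eq) (τ-inverse ∞≢i ∞≢j f h′))

    -- The block through (i , h) and (j , h′) names f as its point in group ∞.
    τ-sharp : ∀ {i j} (∞≢i : ∞ ≢ i) → i ≢ j → ∀ h h′ → ∃! _≡_ λ f → τ ∞≢i j f h ≡ h′
    τ-sharp {i} {j} ∞≢i i≢j h h′ with line i≢j h h′
    ... | b , refl , refl = pt b ∞ , τ-unique ∞≢i b j , λ {f} eq →
      let b′ , eq∞ , eqᵢ = line ∞≢i f (pt b i)
      in trans (sym (agree i≢j b′ b eqᵢ eq ∞)) eq∞

  module Assemble {u w s r α β : ℕ} (𝔾 : FiniteAbelianGroup u) (j₀ : Fin u)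
    (total : FiniteAbelianGroup.sum 𝔾 (to (FiniteAbelianGroup.enum 𝔾)) ≡ FiniteAbelianGroup.0# 𝔾)
    (D : HasTD w)
    (𝒮 : Schedules.Sch 𝔾 (Orders.HasOrder 𝔾 α) (Orders.HasOrder 𝔾 β) w s r) where
    open FiniteAbelianGroup 𝔾
    open Orders 𝔾
    open Schedules.Schedule 𝒮
    open Transitions D (# 3)

    F : Set
    F = Fin s ⊎ Fin r

    Y : Set
    Y = G × Fin w

    three-bijections : ∀ f₂ → Σ (Fin 3 → Fin u ↔ G) λ a →
      ∀ k → (to (a (# 0)) k + to (a (# 1)) k) + to (a (# 2)) k ≡ shift (to rows (f₂ , k))
    three-bijections f₂ = Exchange.sum-of-three-bijections 𝔾 total j₀ _ (balanced f₂)

    record Layer : Set where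
      field
        {source target} : Fin 4
        source≢target : source ≢ target
        3≢source : # 3 ≢ source
        3≢target : # 3 ≢ target
        offset : Fin w → Fin u ↔ G
    open Layer

    pass : Layer → Fin w × Fin u → Y → Y
    pass ℒ (f₂ , k) (g , h) = g + to (offset ℒ f₂) k , τ (3≢source ℒ) (target ℒ) f₂ h

    pass-injective : ∀ ℒ f {y y′} → pass ℒ f y ≡ pass ℒ f y′ → y ≡ y′
    pass-injective ℒ (f₂ , k) eq = cong₂ _,_ (+-cancelʳ _ _ _ (cong proj₁ eq))
      (τ-injective (3≢source ℒ) (3≢target ℒ) f₂ (cong proj₂ eq))

    -- The W-coordinates determine the block index f₂; the bijection onto G belonging to f₂ then
    -- determines the row k.
    pass-sharp : ∀ ℒ y y′ → ∃! _≡_ λ f → pass ℒ f y ≡ y′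
    pass-sharp ℒ (g , h) (g′ , h′) with τ-sharp (3≢source ℒ) (source≢target ℒ) h h′
    ... | f₂ , eq₂ , unique₂ = (f₂ , k) , cong₂ _,_ eq₁ eq₂ , λ {f} → unique f
      where
      k : Fin u
      k = from (offset ℒ f₂) (- g + g′)
      eq₁ : g + to (offset ℒ f₂) k ≡ g′
      eq₁ = begin
        g + to (offset ℒ f₂) k ≡⟨ cong (g +_) (strictlyInverseˡ (offset ℒ f₂) _) ⟩
        g + (- g + g′)         ≡⟨ +-assoc g (- g) g′ ⟨
        (g + - g) + g′         ≡⟨ cong (_+ g′) (+-inverseʳ g) ⟩
        0# + g′                ≡⟨ +-identityˡ g′ ⟩
        g′                     ∎
        where open ≡-Reasoning
      unique : ∀ f → pass ℒ f (g , h) ≡ (g′ , h′) → (f₂ , k) ≡ f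
      unique (f₂′ , k′) eq with unique₂ (cong proj₂ eq)
      ... | refl = cong (f₂ ,_) (to-injective (offset ℒ f₂) (+-cancelˡ g _ _ (trans eq₁ (sym (cong proj₁ eq)))))

    negate : G ↔ G
    negate = mk↔ₛ′ -_ -_ ⁻¹-involutive ⁻¹-involutive
      where open import Algebra.Properties.AbelianGroup abelianGroup using (⁻¹-involutive)

    -- `source` and `target` are groups of the design, not parts of the graph: three layers run 0 →
    -- 1 → 2 → 0, and each later pair of layers runs 0 → 1 → 0. Group 3 is reserved for the factor
    -- labels.
    L₀ L₁ L₂ L₀⁻¹ : Layer
    L₀ = record { source = # 0 ; target = # 1 ; source≢target = λ () ; 3≢source = λ () ; 3≢target = λ ()
                ; offset = λ f₂ → proj₁ (three-bijections f₂) (# 0) }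
    L₁ = record { source = # 1 ; target = # 2 ; source≢target = λ () ; 3≢source = λ () ; 3≢target = λ ()
                ; offset = λ f₂ → proj₁ (three-bijections f₂) (# 1) }
    L₂ = record { source = # 2 ; target = # 0 ; source≢target = λ () ; 3≢source = λ () ; 3≢target = λ ()
                ; offset = λ f₂ → proj₁ (three-bijections f₂) (# 2) }
    L₀⁻¹ = record { source = # 1 ; target = # 0 ; source≢target = λ () ; 3≢source = λ () ; 3≢target = λ ()
                ; offset = λ f₂ → negate ↔-∘ proj₁ (three-bijections f₂) (# 0) }

    alternating : ℕ → Layer
    alternating zero = L₀
    alternating (suc zero) = L₀⁻¹
    alternating (suc (suc j)) = alternating j

    layer : ℕ → Layer
    layer zero = L₀
    layer (suc zero) = L₁
    layer (suc (suc zero)) = L₂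
    layer (suc (suc (suc j))) = alternating j

    trip : Fin w × Fin u → ℕ → Y → Y
    trip f zero y = y
    trip f (suc j) y = pass (layer j) f (trip f j y)

    alternating-even : ∀ k → alternating (k ℕ.* 2) ≡ L₀
    alternating-even zero = refl
    alternating-even (suc k) = alternating-even k

    alternating-odd : ∀ k → alternating (suc (k ℕ.* 2)) ≡ L₀⁻¹
    alternating-odd zero = refl
    alternating-odd (suc k) = alternating-odd k

    there-and-back : ∀ f y → pass L₀⁻¹ f (pass L₀ f y) ≡ y
    there-and-back (f₂ , k) (g , h) = cong₂ _,_
      (trans (+-assoc _ _ _) (trans (cong (g +_) (+-inverseʳ _)) (+-identityʳ g)))
      (τ-inverse {# 0} {# 1} (λ ()) (λ ()) f₂ h)

    -- The three offsets add up to the prescribed element, the three transitions along one block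
    -- close up, and each further pair of layers cancels.
    trip-total : ∀ k f y → trip f (3 ℕ.+ k ℕ.* 2) y ≡ (proj₁ y + shift (to rows f) , proj₂ y)
    trip-total zero f@(f₂ , k) (g , h) = cong₂ _,_
      (trans (+-assoc _ _ _) (trans (+-assoc _ _ _) (cong (g +_) (trans (sym (+-assoc _ _ _)) (proj₂ (three-bijections f₂) k)))))
      (trans (cong (τ {# 2} (λ ()) (# 0) f₂) (τ-compose {# 0} {# 1} (λ ()) (λ ()) (# 2) f₂ h))
        (τ-inverse {# 0} {# 2} (λ ()) (λ ()) f₂ h))
    trip-total (suc k) f y = trans (cong₂ (λ l l′ → pass l f (pass l′ f (trip f (3 ℕ.+ k ℕ.* 2) y))) (alternating-odd k) (alternating-even k))
      (trans (there-and-back f _) (trip-total k f y))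

    translate : G → Y → Y
    translate d (g , h) = g + d , h

    iter-translate : ∀ d q y → iter (translate d) q y ≡ (proj₁ y + q · d , proj₂ y)
    iter-translate d zero (g , h) = cong (_, h) (sym (+-identityʳ g))
    iter-translate d (suc q) (g , h) = trans (cong (translate d) (iter-translate d q (g , h)))
      (cong (_, h) (trans (+-assoc g _ d) (cong (g +_) (+-comm _ d))))

    translate-period : ∀ {ℓ d} → HasOrder ℓ d → ExactPeriod ℓ (translate d)
    translate-period {ℓ} {d} order = record
      { period = λ (g , h) → trans (iter-translate d ℓ (g , h))
          (cong (_, h) (trans (cong (g +_) (proj₂ (order ℓ) ℕ.∣-refl)) (+-identityʳ g)))
      ; exact = λ (g , h) q eq → proj₁ (order q)
          (+-cancelˡ g _ _ (trans (cong proj₁ (trans (sym (iter-translate d q (g , h))) eq)) (sym (+-identityʳ g)))) }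

    conjugate-period : ∀ {A B : Set} (π : A ↔ B) {ℓ} {f : A → A} {f′ : B → B} →
      (∀ x → to π (f x) ≡ f′ (to π x)) → ExactPeriod ℓ f′ → ExactPeriod ℓ f
    conjugate-period π {ℓ} {f} {f′} conj P = record
      { period = λ x → to-injective π (trans (iter-conj ℓ x) (ExactPeriod.period P (to π x)))
      ; exact = λ x q eq → ExactPeriod.exact P (to π x) q (trans (sym (iter-conj q x)) (cong (to π) eq)) }
      where
      iter-conj : ∀ q x → to π (iter f q x) ≡ iter f′ q (to π x)
      iter-conj zero x = refl
      iter-conj (suc q) x = trans (conj _) (cong f′ (iter-conj q x))

    points : Fin (u ℕ.* w) ↔ Y
    points = (enum ×-↔ ↔-id (Fin w)) ↔-∘ *↔×

    step : F → ℕ → Fin (u ℕ.* w) → Fin (u ℕ.* w)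
    step f j y = from points (pass (layer j) (from rows f) (to points y))

    step-points : ∀ f j y → to points (step f j y) ≡ pass (layer j) (from rows f) (to points y)
    step-points f j y = strictlyInverseˡ points _

    step-injective : ∀ f j {y y′} → step f j y ≡ step f j y′ → y ≡ y′
    step-injective f j {y} {y′} eq = to-injective points (pass-injective (layer j) (from rows f)
      (trans (sym (step-points f j y)) (trans (cong (to points) eq) (step-points f j y′))))

    step-sharp : ∀ j y y′ → ∃! _≡_ λ f → step f j y ≡ y′
    step-sharp j y y′ = ∃!-bijection rows (∃!-map
      (λ f eq → to-injective points (trans (step-points (to rows f) j y)
        (trans (cong (λ f → pass (layer j) f (to points y)) (strictlyInverseʳ rows f)) eq)))
      (λ f eq → trans (cong (λ f → pass (layer j) f (to points y)) (sym (strictlyInverseʳ rows f)))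
        (trans (sym (step-points (to rows f) j y)) (cong (to points) eq)))
      (pass-sharp (layer j) (to points y) (to points y′)))

    module _ (k : ℕ) where
      n′ : ℕ
      n′ = 2 ℕ.+ k ℕ.* 2

      around : F → ℕ → Fin (u ℕ.* w) → Fin (u ℕ.* w)
      around f = Layered.around {n′ = n′} (step f) (step-injective f)

      around-points : ∀ f j y → to points (around f j y) ≡ trip (from rows f) j (to points y)
      around-points f zero y = refl
      around-points f (suc j) y = trans (step-points f j _) (cong (pass (layer j) (from rows f)) (around-points f j y))

      around-period : ∀ {ℓ} f → HasOrder ℓ (shift f) → ExactPeriod ℓ (around f (suc n′))
      around-period f order = conjugate-period points
        (λ y → trans (around-points f (suc n′) y) (trans (trip-total k (from rows f) (to points y))
          (cong (λ f → translate (shift f) (to points y)) (strictlyInverseˡ rows f))))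
        (translate-period order)

      decomposition : 1 ≤ α → 1 ≤ β → Decomp (u ℕ.* w) (suc n′) s (α ℕ.* suc n′) r (β ℕ.* suc n′)
      decomposition 1≤α 1≤β = layered-decomposition (s≤s (s≤s (s≤s z≤n))) 1≤α 1≤β step step-injective step-sharp
        (λ f → around-period (inj₁ f) (left-ok f)) (λ f → around-period (inj₂ f) (right-ok f))

open LatinSquareFactors

-- The choice of group and the six cases

open import Defs
open import Data.Nat using (_+_; _*_)
open import Data.Nat.Divisibility as ℕ using (_∣_; divides)
open import Data.Nat.GCD using (gcd)

IsOdd⇒NonZero : ∀ {n} → IsOdd n → NonZero n
IsOdd⇒NonZero (_ , refl) = _

IsOdd⇒1≤ : ∀ {n} → IsOdd n → 1 ≤ n
IsOdd⇒1≤ (_ , refl) = s≤s z≤n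

-- Blocks in which neither half is a singleton realise all totals if u ≥ 5; for smaller u the two
-- orders agree or one of them is 1, and then singletons do no harm.
data Mode (u α β : ℕ) : Set where
  large : 5 ≤ u → Mode u α β
  same : α ≡ β → (u ≡ 1 → α ≡ 1) → Mode u α β
  right-trivial : 3 ≤ u → β ≡ 1 → Mode u α β
  left-trivial : 3 ≤ u → α ≡ 1 → Mode u α β

module _ {u : ℕ} (𝔾 : FiniteAbelianGroup u) where
  open Orders 𝔾
  open Schedules 𝔾

  schedule : ∀ {α β} → ZeroSumPieces (HasOrder α) → ZeroSumPieces (HasOrder β) → Mode u α β →
    ∀ w {s r} → s + r ≡ suc w * u → s ≢ 1 → r ≢ 1 → Sch (HasOrder α) (HasOrder β) (suc w) s r
  schedule a b (large 5≤u) w s+r≡ s≢1 r≢1 =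
    split-both 5≤u (λ s+r≡u s≢1 r≢1 → block s+r≡u (zero-sum a _ s≢1) (zero-sum b _ r≢1)) w s+r≡ s≢1 r≢1
  schedule {α} a b (same refl u≡1⇒α≡1) w s+r≡ _ _ = split-any (λ s+r≡u → mixed-block s+r≡u all) w s+r≡
    where
    all : ZeroSum (HasOrder α) u
    -- A group with one element has room only for the family consisting of 0, of order 1.
    all with u ℕ.≟ 1
    ... | yes u≡1 = subst (λ α → ZeroSum (HasOrder α) u) (sym (u≡1⇒α≡1 u≡1)) (zero-sum-0# u)
    ... | no u≢1 = zero-sum a u u≢1
  schedule a b (right-trivial 3≤u refl) w s+r≡ s≢1 _ =
    split-left 3≤u (λ s+r≡u s≢1 → block s+r≡u (zero-sum a _ s≢1) (zero-sum-0# _)) w s+r≡ s≢1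
  schedule a b (left-trivial 3≤u refl) w {s} {r} s+r≡ _ r≢1 = swap-Schedule
    (split-left 3≤u (λ s+r≡u s≢1 → block s+r≡u (zero-sum b _ s≢1) (zero-sum-0# _)) w (trans (ℕ.+-comm r s) s+r≡) r≢1)

  group-decomposition : ∀ {α β} → 1 ≤ u → 1 ≤ α → 1 ≤ β → FixedPointFreeAutomorphism →
    ZeroSumPieces (HasOrder α) → ZeroSumPieces (HasOrder β) → Mode u α β →
    ∀ {n} → IsOdd n → 3 ≤ n → ∀ w → 1 ≤ w → w ≢ 2 → w ≢ 6 → ∀ {s r} → s ≢ 1 → r ≢ 1 → s + r ≡ u * w →
    Decomp (u * w) n s (α * n) r (β * n)
  group-decomposition 1≤u 1≤α 1≤β φ a b mode (zero , refl) (s≤s ()) w@(suc w′)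
  group-decomposition {α} {β} 1≤u 1≤α 1≤β φ a b mode {n} (suc h , refl) _ w@(suc w′) 1≤w w≢2 w≢6 {s} {r} s≢1 r≢1 s+r≡uw =
    subst (λ n → Decomp (u * w) n s (α * n) r (β * n)) (lemma h)
      (Assemble.decomposition 𝔾 (fromℕ< 1≤u) (total-sum≡0 φ) (four-group-TD w 1≤w w≢2 w≢6)
        (schedule a b mode w′ (trans s+r≡uw (ℕ.*-comm u w)) s≢1 r≢1) h 1≤α 1≤β)
    where
    lemma : ∀ h → 3 + h * 2 ≡ suc (2 * suc h)
    lemma = solve-∀

-- An odd u below 5 is 1 or 3, whose divisors leave only equal orders or an order 1.
cyclic-mode : ∀ u α β → IsOdd u → α ∣ u → β ∣ u → Mode u α β
cyclic-mode u α β (h , refl) α∣u β∣u = mode h α∣u β∣u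
  where
  divisor-of-3 : ∀ d → d ∣ 3 → d ≡ 1 ⊎ d ≡ 3
  divisor-of-3 0 (divides k eq) = contradiction (trans eq (ℕ.*-zeroʳ k)) λ ()
  divisor-of-3 1 _ = inj₁ refl
  divisor-of-3 2 (divides k eq) = contradiction (trans eq (ℕ.*-comm k 2)) (odd≢even k)
    where
    odd≢even : ∀ k → 3 ≢ 2 * k
    odd≢even 1 ()
    odd≢even (suc (suc k)) eq = contradiction (trans eq (ℕ.*-distribˡ-+ 2 2 k)) λ ()
  divisor-of-3 3 _ = inj₂ refl
  divisor-of-3 (suc (suc (suc (suc d)))) d∣3 = contradiction (ℕ.∣⇒≤ d∣3) λ { (s≤s (s≤s (s≤s ()))) }

  mode : ∀ h → α ∣ suc (2 * h) → β ∣ suc (2 * h) → Mode (suc (2 * h)) α β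
  mode 0 α∣1 β∣1 = same (trans (ℕ.∣1⇒≡1 α∣1) (sym (ℕ.∣1⇒≡1 β∣1))) (λ _ → ℕ.∣1⇒≡1 α∣1)
  mode 1 α∣3 β∣3 with divisor-of-3 α α∣3 | divisor-of-3 β β∣3
  ... | inj₁ α≡1 | _ = left-trivial ℕ.≤-refl α≡1
  ... | inj₂ α≡3 | inj₁ β≡1 = right-trivial ℕ.≤-refl β≡1
  ... | inj₂ α≡3 | inj₂ β≡3 = same (trans α≡3 (sym β≡3)) λ ()
  mode (suc (suc h)) _ _ = large (s≤s (ℕ.*-monoʳ-≤ 2 (s≤s (s≤s (z≤n {h})))))

-- The element orders in use: ℓ with component 0 in ℤ₂², and 2ℓ with an involution there. The
-- cofactor p gives the cyclic component as a multiple of p.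
data KleinOrder (m : ℕ) : ℕ → Set where
  odd-order : ∀ ℓ p → IsOdd ℓ → IsOdd p → m ≡ ℓ * p → KleinOrder m ℓ
  even-order : ∀ ℓ p → IsOdd ℓ → IsOdd p → m ≡ ℓ * p → KleinOrder m (2 * ℓ)

-- For m ≥ 3 the group has at least 12 elements. For m = 1 it has 4, and each order is 1 or 2:
-- either one order is trivial or both are 2.
klein-mode : ∀ m {α β} → IsOdd m → KleinOrder m α → KleinOrder m β → Mode (4 * m) α β
klein-mode m (suc h , refl) _ _ = large (ℕ.≤-trans (ℕ.m≤m+n 5 _) (ℕ.*-monoʳ-≤ 4 (s≤s (s≤s (z≤n {h + (1 + h + 0)})))))
klein-mode m (zero , refl) (odd-order ℓ p _ _ 1≡ℓp) _ = left-trivial (s≤s (s≤s (s≤s z≤n))) (ℕ.m*n≡1⇒m≡1 ℓ p (sym 1≡ℓp))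
klein-mode m (zero , refl) _ (odd-order ℓ p _ _ 1≡ℓp) = right-trivial (s≤s (s≤s (s≤s z≤n))) (ℕ.m*n≡1⇒m≡1 ℓ p (sym 1≡ℓp))
klein-mode m (zero , refl) (even-order ℓ p _ _ 1≡ℓp) (even-order ℓ′ p′ _ _ 1≡ℓ′p′) =
  same (cong (2 *_) (trans (ℕ.m*n≡1⇒m≡1 ℓ p (sym 1≡ℓp)) (sym (ℕ.m*n≡1⇒m≡1 ℓ′ p′ (sym 1≡ℓ′p′))))) λ ()

klein-pieces : ∀ m .{{_ : NonZero m}} {α} → KleinOrder m α →
  Orders.ZeroSumPieces (KleinTimesCyclic.group m) (Orders.HasOrder (KleinTimesCyclic.group m) α)
klein-pieces m (odd-order ℓ p odd odd-p m≡ℓp) = KleinTimesCyclic.odd-pieces m ℓ p {{IsOdd⇒NonZero odd-p}} m≡ℓp odd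
klein-pieces m (even-order ℓ p odd odd-p m≡ℓp) = KleinTimesCyclic.even-pieces m ℓ p {{IsOdd⇒NonZero odd-p}} m≡ℓp odd

KleinOrder⇒1≤ : ∀ {m α} → KleinOrder m α → 1 ≤ α
KleinOrder⇒1≤ (odd-order _ _ odd _ _) = IsOdd⇒1≤ odd
KleinOrder⇒1≤ (even-order _ _ (_ , refl) _ _) = s≤s z≤n

klein-decomposition : ∀ {m} → IsOdd m → ∀ {α β} → KleinOrder m α → KleinOrder m β →
  ∀ {n} → IsOdd n → 3 ≤ n → ∀ w → 1 ≤ w → w ≢ 2 → w ≢ 6 → ∀ {s r} → s ≢ 1 → r ≢ 1 → s + r ≡ 4 * m * w →
  Decomp (4 * m * w) n s (α * n) r (β * n)
klein-decomposition {m} odd@(_ , refl) a b =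
  group-decomposition (KleinTimesCyclic.group m) (s≤s z≤n) (KleinOrder⇒1≤ a) (KleinOrder⇒1≤ b)
    (KleinTimesCyclic.automorphism m odd) (klein-pieces m a) (klein-pieces m b) (klein-mode m odd a b)

cyclic-decomposition : ∀ {x y z} → IsOdd x → IsOdd y → IsOdd z →
  ∀ {n} → IsOdd n → 3 ≤ n → ∀ w → 1 ≤ w → w ≢ 2 → w ≢ 6 → ∀ {s r} → s ≢ 1 → r ≢ 1 → s + r ≡ x * y * z * w →
  Decomp (x * y * z * w) n s (x * z * n) r (y * z * n)
cyclic-decomposition {x} {y} {z} odd-x odd-y odd-z =
  group-decomposition (Residues.residues u) (IsOdd⇒1≤ odd-u) (IsOdd⇒1≤ odd-xz) (IsOdd⇒1≤ odd-yz)
    (CyclicPieces.negation u odd-u)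
    (CyclicPieces.cyclic-pieces u (x * z) y (u≡xzy x y z) odd-xz)
    (CyclicPieces.cyclic-pieces u (y * z) x (u≡yzx x y z) odd-yz)
    (cyclic-mode u (x * z) (y * z) odd-u
      (divides y (trans (u≡xzy x y z) (ℕ.*-comm (x * z) y))) (divides x (trans (u≡yzx x y z) (ℕ.*-comm (y * z) x))))
  where
  u : ℕ
  u = x * y * z
  odd-u : IsOdd u
  odd-u = *-IsOdd (*-IsOdd odd-x odd-y) odd-z
  odd-xz : IsOdd (x * z)
  odd-xz = *-IsOdd odd-x odd-z
  odd-yz : IsOdd (y * z)
  odd-yz = *-IsOdd odd-y odd-z
  instance
    x-nonZero : NonZero x
    x-nonZero = IsOdd⇒NonZero odd-x
    y-nonZero : NonZero y
    y-nonZero = IsOdd⇒NonZero odd-y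
    u-nonZero : NonZero u
    u-nonZero = IsOdd⇒NonZero odd-u
  u≡xzy : ∀ x y z → x * y * z ≡ x * z * y
  u≡xzy = solve-∀
  u≡yzx : ∀ x y z → x * y * z ≡ y * z * x
  u≡yzx = solve-∀

theorem8p3 : (x y z n w s r : ℕ) →
    Odd x → Odd y → Odd z → Odd n → 3 ≤ n →
    gcd x z ≡ 1 → gcd y z ≡ 1 →
    1 ≤ w → w ≢ 2 → w ≢ 6 → s ≢ 1 → r ≢ 1 →
    (s + r ≡ x * y * z * w →
    Decomp (x * y * z * w) n s (x * z * n) r (y * z * n))
    × (s + r ≡ 4 * x * z * w →
    Decomp (4 * x * z * w) n s (2 * x * z * n) r (2 * z * n))
    × (s + r ≡ 4 * x * z * w →
    Decomp (4 * x * z * w) n s (2 * x * z * n) r (z * n))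
    × (s + r ≡ 4 * x * z * w →
    Decomp (4 * x * z * w) n s (x * z * n) r (2 * z * n))
    × (s + r ≡ 4 * x * y * z * w →
    Decomp (4 * x * y * z * w) n s (2 * x * z * n) r (y * z * n))
    × (s + r ≡ 4 * x * y * z * w →
    Decomp (4 * x * y * z * w) n s (2 * x * z * n) r (2 * y * z * n))
theorem8p3 x y z n w s r odd-x odd-y odd-z odd-n 3≤n _ _ 1≤w w≢2 w≢6 s≢1 r≢1 =
    cyclic-decomposition ox oy oz on 3≤n w 1≤w w≢2 w≢6 s≢1 r≢1
  , via-klein oxz (four-xz x z) even-xz even-z (sym (ℕ.*-assoc 2 x z)) refl
  , via-klein oxz (four-xz x z) even-xz (odd-order z x oz ox (ℕ.*-comm x z)) (sym (ℕ.*-assoc 2 x z)) refl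
  , via-klein oxz (four-xz x z) (odd-order (x * z) 1 oxz (0 , refl) (sym (ℕ.*-identityʳ (x * z)))) even-z refl refl
  , via-klein oxyz (four-xyz x y z) even-xz′ (odd-order (y * z) x oyz ox (yz-cofactor x y z)) (sym (ℕ.*-assoc 2 x z)) refl
  , via-klein oxyz (four-xyz x y z) even-xz′ (even-order (y * z) x oyz ox (yz-cofactor x y z)) (sym (ℕ.*-assoc 2 x z)) (sym (ℕ.*-assoc 2 y z))
  where
  ox : IsOdd x
  ox = odd⇒IsOdd odd-x
  oy : IsOdd y
  oy = odd⇒IsOdd odd-y
  oz : IsOdd z
  oz = odd⇒IsOdd odd-z
  on : IsOdd n
  on = odd⇒IsOdd odd-n
  oxz : IsOdd (x * z)
  oxz = *-IsOdd ox oz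
  oyz : IsOdd (y * z)
  oyz = *-IsOdd oy oz
  oxyz : IsOdd (x * y * z)
  oxyz = *-IsOdd (*-IsOdd ox oy) oz

  xz-cofactor : ∀ x y z → x * y * z ≡ x * z * y
  xz-cofactor = solve-∀
  yz-cofactor : ∀ x y z → x * y * z ≡ y * z * x
  yz-cofactor = solve-∀
  four-xz : ∀ x z → 4 * (x * z) ≡ 4 * x * z
  four-xz = solve-∀
  four-xyz : ∀ x y z → 4 * (x * y * z) ≡ 4 * x * y * z
  four-xyz = solve-∀

  even-xz : KleinOrder (x * z) (2 * (x * z))
  even-xz = even-order (x * z) 1 oxz (0 , refl) (sym (ℕ.*-identityʳ (x * z)))
  even-z : KleinOrder (x * z) (2 * z)
  even-z = even-order z x oz ox (ℕ.*-comm x z)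
  even-xz′ : KleinOrder (x * y * z) (2 * (x * z))
  even-xz′ = even-order (x * z) y oxz oy (xz-cofactor x y z)

  -- Absorbs the bracketing: the statement multiplies from the left, whereas group and element
  -- orders arise as `4 * m` and `2 * ℓ`.
  via-klein : ∀ {m u α β α′ β′} → IsOdd m → 4 * m ≡ u → KleinOrder m α → KleinOrder m β → α ≡ α′ → β ≡ β′ →
    s + r ≡ u * w → Decomp (u * w) n s (α′ * n) r (β′ * n)
  via-klein odd refl a b refl refl = klein-decomposition odd a b on 3≤n w 1≤w w≢2 w≢6 s≢1 r≢1
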